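{- Let $k\geq2$ and $n\geq2$. Then the matching preclusion number of the DCell is $mp(D_{k,n})=n+k-1$. Moreover, $D_{k,n}$ is super matched.
   Context: DCell $D_{k,n}$ ($n\geq 2$, $k\geq 0$) is defined recursively. $D_{0,n}$ is the complete graph $K_n$ on vertices $0,1,\dots,n-1$. Let $t_{k,n}=|V(D_{k,n})|$. For $k\geq1$, $D_{k,n}$ is built from $t_{k-1,n}+1$ disjoint copies $D^0_{k-1,n},\dots,D^{t_{k-1,n}}_{k-1,n}$ of $D_{k-1,n}$; a vertex of copy $D^i_{k-1,n}$ is labeled $(i,a_{k-1},\dots,a_0)$, where $(a_{k-1},\dots,a_0)$ is its label in $D_{k-1,n}$, and its index within the copy is $uid_{k-1}=a_0+\sum_{l=1}^{k-1}a_l t_{l-1,n}$. For each pair $a<b$ of copy indices, one edge joins the vertex of $D^a_{k-1,n}$ with $uid_{k-1}=b-1$ to the vertex of $D^b_{k-1,n}$ with $uid_{k-1}=a$. $D_{k,n}$ is $(n+k-1)$-regular of even order for $k\geq1$. For a graph $G$ of even order, a matching preclusion set is an edge set $F$ such that $G-F$ has no perfect matching; $mp(G)$ is the minimum size of such a set, and such minimum sets are optimal. A trivial matching preclusion set is the set of all edges incident to one vertex. $G$ is super matched if $mp(G)=\delta(G)$ and every optimal matching preclusion set is trivial. -}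

module Defs where

open import Data.Nat using (ℕ; zero; suc; _+_; _*_; _∸_; _≤_; _<ᵇ_; _≡ᵇ_)
open import Data.Nat.DivMod using (_/_; _%_)
open import Data.Bool using (Bool; true; false; _∧_; _∨_; not)
open import Data.Fin using (Fin; toℕ)
open import Data.List using (List; length; filterᵇ; allFin)
open import Data.List.Membership.Propositional using (_∈_)
open import Data.List.Relation.Unary.All using (All)
open import Data.List.Relation.Unary.AllPairs using (AllPairs)
open import Data.Product using (Σ; ∃; _×_; _,_; proj₁; proj₂)
open import Data.Sum using (_⊎_)
open import Relation.Binary.PropositionalEquality using (_≡_)
open import Relation.Nullary using (¬_)

-- DCell D_{k,n}.
-- A vertex of D_{k,n} is identified with its index uid_k ∈ {0,…,t_{k,n}-1}.
-- For k ≥ 1, the vertex labelled (i, a_{k-1},…,a_0) has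
--   uid_k = i * t_{k-1,n} + uid_{k-1}(a_{k-1},…,a_0).

t : ℕ → ℕ → ℕ
t zero    n = n
t (suc k) n = t k n * (t k n + 1)

split : ℕ → ℕ → ℕ × ℕ
split zero    u = (0 , u)
split (suc m) u = (u / suc m , u % suc m)

-- cross edge between (copy a, uid x) and (copy b, uid y):
-- a < b, x = b - 1, y = a
cross : ℕ → ℕ → ℕ → ℕ → Bool
cross a x b y = (a <ᵇ b) ∧ ((x ≡ᵇ (b ∸ 1)) ∧ (y ≡ᵇ a))

adj : ℕ → ℕ → ℕ → ℕ → Bool
adj zero    n u v = (u <ᵇ n) ∧ ((v <ᵇ n) ∧ not (u ≡ᵇ v))
adj (suc k) n u v =
  (u <ᵇ t (suc k) n) ∧ ((v <ᵇ t (suc k) n) ∧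
    (((proj₁ (split T u) ≡ᵇ proj₁ (split T v)) ∧ adj k n (proj₂ (split T u)) (proj₂ (split T v)))
     ∨ (cross (proj₁ (split T u)) (proj₂ (split T u)) (proj₁ (split T v)) (proj₂ (split T v))
     ∨ cross (proj₁ (split T v)) (proj₂ (split T v)) (proj₁ (split T u)) (proj₂ (split T u)))))
  where
  T = t k n

DCell : (k n : ℕ) → Fin (t k n) → Fin (t k n) → Bool
DCell k n u v = adj k n (toℕ u) (toℕ v)

module _ {N : ℕ} (A : Fin N → Fin N → Bool) where

  Edge : Set
  Edge = Fin N × Fin N

  SameEdge : Edge → Edge → Set
  SameEdge (a , b) (c , d) = (a ≡ c × b ≡ d) ⊎ (a ≡ d × b ≡ c)

  -- F is a set of edges of the graph (no repeated edges); |F| = length F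
  IsEdgeSet : List Edge → Set
  IsEdgeSet F = All (λ e → A (proj₁ e) (proj₂ e) ≡ true) F
              × AllPairs (λ e e′ → ¬ SameEdge e e′) F

  Delete : List Edge → Fin N → Fin N → Set
  Delete F u v = (A u v ≡ true) × (¬ ((u , v) ∈ F) × ¬ ((v , u) ∈ F))

  -- perfect matching of a graph with adjacency R: fixed-point free involution along edges
  PerfectMatching : (Fin N → Fin N → Set) → Set
  PerfectMatching R = Σ (Fin N → Fin N) λ m →
    (∀ x → m (m x) ≡ x) × (∀ x → R x (m x))

  IsMatchingPreclusionSet : List Edge → Set
  IsMatchingPreclusionSet F = IsEdgeSet F × ¬ PerfectMatching (Delete F)

  IsMPNumber : ℕ → Set
  IsMPNumber m = (∃ λ F → IsMatchingPreclusionSet F × length F ≡ m)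
               × (∀ F → IsMatchingPreclusionSet F → m ≤ length F)

  IsTrivial : List Edge → Set
  IsTrivial F = ∃ λ v → (∀ e → e ∈ F → proj₁ e ≡ v ⊎ proj₂ e ≡ v)
                      × (∀ u → A v u ≡ true → (v , u) ∈ F ⊎ (u , v) ∈ F)

  degree : Fin N → ℕ
  degree v = length (filterᵇ (A v) (allFin N))

  IsMinDegree : ℕ → Set
  IsMinDegree d = (∀ v → d ≤ degree v) × (∃ λ v → degree v ≡ d)

  SuperMatched : Set
  SuperMatched = Σ ℕ λ d → IsMinDegree d × IsMPNumber d
    × (∀ F → IsMatchingPreclusionSet F → length F ≡ d → IsTrivial F)

{-# OPTIONS --safe #-}
module Submission where

-- The cross edges of D_k form a perfect matching, and the other edges lie in copies of D_(k-1).
-- Hence a 1-factorization of D_(k-1) with d colours extends to one of D_k with d + 1 colours, and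
-- fewer faults than colours leave some colour class untouched: mp(D_k) is the degree. The recursion
-- starts at K_n for even n and at D_1 for odd n, where a 1-factorization of K_(n+1) acts on the
-- ordered pairs that are the vertices of D_1.
--
-- Now let the d + 1 faults of D_k hit every matching obtained by choosing a colour copy by copy, and
-- the cross matching. Then one cross edge e is faulty, and the other faults lie in a single
-- copy i, one in each colour. Unless all of them share an end with e, which makes the faults a star,
-- some faulty edge x–y of copy i misses e. Take its colour class, drop x–y and reconnect x and y
-- through the cross edges along a cycle of four copies that avoids e. In each of the three other
-- copies two vertices are used up, so this works if D_(k-1) is bicritical (it has a perfect
-- matching after removing any two vertices), a property which in turn passes from D_(k-1) to D_k.

open import Defs
open import Data.Bool as Bool using (Bool; true; _∧_; _∨_; not)
open import Data.Bool.Properties using (T-≡; T-∧; T-∨; T-not-≡; ¬-not)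
open import Data.Fin using (Fin; zero; suc; toℕ; fromℕ<; opposite; punchIn; punchOut; combine; remQuot; cast; #_)
open import Data.Fin.Properties as Fin using (any?; all?; pigeonhole; injective⇒≤; suc-injective;
  toℕ-injective; toℕ<n; toℕ-cast; toℕ-combine; toℕ-fromℕ<; remQuot-combine; combine-remQuot; cast-involutive;
  punchIn-injective; punchInᵢ≢i; punchIn-punchOut; punchOut-injective)
open import Data.List using (List; []; _∷_; _++_; concatMap; length; lookup; tabulate; filterᵇ; allFin)
open import Data.List.Properties using (length-tabulate)
open import Data.List.Membership.Propositional using (_∈_)
open import Data.List.Membership.Propositional.Properties using (∈-filter⁺; ∈-filter⁻; ∈-lookup; ∈-allFin; ∈-tabulate⁺)
open import Data.List.Relation.Unary.All as All using (All; []; _∷_)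
open import Data.List.Relation.Unary.All.Properties as All using (¬Any⇒All¬)
open import Data.List.Relation.Unary.AllPairs using ([]; _∷_)
open import Data.List.Relation.Unary.AllPairs.Properties as AllPairs using ()
open import Data.List.Relation.Unary.Any as Any using (Any)
open import Data.List.Relation.Unary.Any.Properties using (lookup-index)
open import Data.List.Relation.Unary.Unique.Propositional using (Unique)
open import Data.List.Relation.Unary.Unique.Propositional.Properties using (filter⁺; allFin⁺)
open import Data.Maybe using (Maybe; just; nothing; from-just)
open import Data.Nat as ℕ using (ℕ; zero; suc; _+_; _*_; _∸_; _≤_; _<_; z≤n; s≤s; _<ᵇ_; _≡ᵇ_)
open import Data.Nat.Properties as ℕ using (<ᵇ⇒<; <⇒<ᵇ; ≡ᵇ⇒≡; ≡⇒≡ᵇ; *-comm)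
open import Data.Nat.Divisibility using (m∣m*n)
open import Data.Nat.DivMod using (_/_; _%_; m%n<n; m%n%n≡m%n; m<n⇒m%n≡m; [m+n]%n≡m%n; [m+kn]%n≡m%n;
  %-distribˡ-+; %-distribˡ-*; +-distrib-/-∣ˡ; m*n/n≡m; m<n⇒m/n≡0)
open import Data.Nat.Tactic.RingSolver using (solve-∀)
open import Data.Product using (Σ; ∃; _×_; _,_; proj₁; proj₂)
open import Data.Product.Properties using (≡-dec)
open import Data.Sum as Sum using (_⊎_; inj₁; inj₂)
open import Data.Unit using (⊤; tt)
open import Data.Vec as Vec using ([]; _∷_)
open import Function using (_∘_; id; Equivalence)
open import Relation.Binary using (DecidableEquality; Symmetric; tri<; tri≈; tri>)
open import Relation.Binary.PropositionalEquality
open import Relation.Nullary using (¬_; Dec; yes; no; ¬?; contradiction; _×-dec_; _⊎-dec_)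
open import Relation.Nullary.Decidable using (decidable-stable; toWitness; _→-dec_)
open import Relation.Unary using (Decidable)

-- Search and counting in finite sets.

∃-or-∀ : ∀ {n} {P : Fin n → Set} → Decidable P → ∃ P ⊎ (∀ i → ¬ P i)
∃-or-∀ P? with any? P?
... | yes p = inj₁ p
... | no ¬p = inj₂ λ i pi → ¬p (i , pi)

∀-or-∃ : ∀ {n} {P Q : Fin n → Set} → (∀ i → P i ⊎ Q i) → (∀ i → P i) ⊎ ∃ Q
∀-or-∃ {zero} h = inj₁ λ ()
∀-or-∃ {suc n} h with h zero | ∀-or-∃ (h ∘ suc)
... | inj₂ q | _ = inj₂ (zero , q)
... | inj₁ _ | inj₂ (i , q) = inj₂ (suc i , q)
... | inj₁ p | inj₁ ps = inj₁ λ { zero → p ; (suc i) → ps i }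

-- If s were missed, punching it out would inject `Fin (suc n)` into `Fin n`.
injective⇒surjective : ∀ {n} (f : Fin n → Fin n) → (∀ {i j} → f i ≡ f j → i ≡ j) → ∀ s → ∃ λ i → f i ≡ s
injective⇒surjective {suc n} f f-inj s with any? (λ i → f i Fin.≟ s)
... | yes p = p
... | no ¬p = contradiction (injective⇒≤ g-inj) ℕ.1+n≰n
  where
  s≢ : ∀ i → s ≢ f i
  s≢ i e = ¬p (i , sym e)
  g-inj : ∀ {i j} → punchOut (s≢ i) ≡ punchOut (s≢ j) → i ≡ j
  g-inj = f-inj ∘ punchOut-injective (s≢ _) (s≢ _)

-- Otherwise the positions of the elements in `xs` would inject `Fin n` into a smaller set.
fresh : ∀ {n} (xs : List (Fin n)) → length xs < n → ∃ λ i → All (i ≢_) xs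
fresh xs short with ∃-or-∀ (λ i → ¬? (Any.any? (i Fin.≟_) xs))
... | inj₁ (i , i∉) = i , ¬Any⇒All¬ xs i∉
... | inj₂ all = contradiction (injective⇒≤ index-injective) (ℕ.<⇒≱ short)
  where
  i∈ : ∀ i → Any (i ≡_) xs
  i∈ i = decidable-stable (Any.any? (i Fin.≟_) xs) (all i)
  index-injective : ∀ {i j} → Any.index (i∈ i) ≡ Any.index (i∈ j) → i ≡ j
  index-injective {i} {j} eq = trans (lookup-index (i∈ i)) (trans (cong (lookup xs) eq) (sym (lookup-index (i∈ j))))

-- Perfect matchings, deficient pairs and rotations.

module Matching {V : Set} (_≟_ : DecidableEquality V) where

  swap : V → V → V → V
  swap a b u with u ≟ a
  ... | yes _ = b
  ... | no _ with u ≟ b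
  ... | yes _ = a
  ... | no _ = u

  swap-l : ∀ a b → swap a b a ≡ b
  swap-l a b with a ≟ a
  ... | yes _ = refl
  ... | no a≢a = contradiction refl a≢a

  swap-r : ∀ a b → swap a b b ≡ a
  swap-r a b with b ≟ a
  ... | yes b≡a = b≡a
  ... | no _ with b ≟ b
  ... | yes _ = refl
  ... | no b≢b = contradiction refl b≢b

  swap-o : ∀ {a b u} → u ≢ a → u ≢ b → swap a b u ≡ u
  swap-o {a} {b} {u} u≢a u≢b with u ≟ a
  ... | yes u≡a = contradiction u≡a u≢a
  ... | no _ with u ≟ b
  ... | yes u≡b = contradiction u≡b u≢b
  ... | no _ = refl

  swap-involutive : ∀ a b u → swap a b (swap a b u) ≡ u
  swap-involutive a b u with u ≟ a
  ... | yes u≡a = trans (swap-r a b) (sym u≡a)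
  ... | no u≢a with u ≟ b
  ... | yes u≡b = trans (swap-l a b) (sym u≡b)
  ... | no u≢b = swap-o u≢a u≢b

  -- Matchings are altered by relabelling, because a conjugate of an involution is again an
  -- involution, without any case distinction.
  conj : V → V → (V → V) → V → V
  conj a b m = swap a b ∘ m ∘ swap a b

  conj-involutive : ∀ a b {m} → (∀ u → m (m u) ≡ u) → ∀ u → conj a b m (conj a b m u) ≡ u
  conj-involutive a b {m} inv u = begin
    conj a b m (conj a b m u)   ≡⟨ cong (swap a b ∘ m) (swap-involutive a b _) ⟩
    swap a b (m (m (swap a b u))) ≡⟨ cong (swap a b) (inv _) ⟩
    swap a b (swap a b u)       ≡⟨ swap-involutive a b u ⟩
    u ∎
    where open ≡-Reasoning

  record Perfect (R : V → V → Set) : Set where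
    field
      mate : V → V
      involutive : ∀ u → mate (mate u) ≡ u
      ok : ∀ u → R u (mate u)

  -- A perfect matching of the graph R with the edge x–w added, using that edge.
  record Near (R : V → V → Set) (x w : V) : Set where
    field
      mate : V → V
      involutive : ∀ u → mate (mate u) ≡ u
      at : mate x ≡ w
      ok : ∀ u → u ≢ x → u ≢ w → R u (mate u)

  -- A perfect matching left after removing x and w is recorded with x-w as an extra pair, so that
  -- `mate` stays a total involution on V.
  Bicritical : (V → V → Set) → Set
  Bicritical R = ∀ x w → x ≢ w → Near R x w

  module _ {R : V → V → Set} where

    near-sym : ∀ {x w} → Near R x w → Near R w x
    near-sym N = record
      { mate = mate ; involutive = involutive
      ; at = trans (cong mate (sym at)) (involutive _)
      ; ok = λ u u≢w u≢x → ok u u≢x u≢w }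
      where open Near N

    close : Symmetric R → ∀ {x w} → Near R x w → R x w → Perfect R
    close R-sym {x} {w} N xw = record { mate = mate ; involutive = involutive ; ok = ok′ }
      where
      open Near N
      ok′ : ∀ u → R u (mate u)
      ok′ u with u ≟ x
      ... | yes refl = subst (R x) (sym at) xw
      ... | no u≢x with u ≟ w
      ... | yes refl = subst (R w) (sym (Near.at (near-sym N))) (R-sym xw)
      ... | no u≢w = ok u u≢x u≢w

    -- Conjugating m by the transposition of w and r turns the pairs x–w, s–r into x–r, s–w.
    exchange : Symmetric R → ∀ {x w s r} (m : V → V) → (∀ u → m (m u) ≡ u) → m x ≡ w → m s ≡ r →
      (∀ u → u ≢ x → u ≢ w → u ≢ s → u ≢ r → R u (m u)) →
      x ≢ w → s ≢ r → s ≢ x → s ≢ w → R w s →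
      Σ (Near R x r) λ N → ∀ u → u ≢ x → u ≢ w → u ≢ s → u ≢ r → Near.mate N u ≡ m u
    exchange R-sym {x} {w} {s} {r} m inv mx ms ok x≢w s≢r s≢x s≢w ws =
      record { mate = m′ ; involutive = conj-involutive w r {m} inv ; at = m′x ; ok = ok′ } , keep
      where
      m′ = conj w r m
      mw : m w ≡ x
      mw = trans (cong m (sym mx)) (inv x)
      mr : m r ≡ s
      mr = trans (cong m (sym ms)) (inv s)
      x≢r : x ≢ r
      x≢r x≡r = s≢w (trans (sym mr) (trans (cong m (sym x≡r)) mx))
      m′x : m′ x ≡ r
      m′x = trans (cong (swap w r ∘ m) (swap-o x≢w x≢r)) (trans (cong (swap w r) mx) (swap-l w r))
      m′w : m′ w ≡ s
      m′w = trans (cong (swap w r ∘ m) (swap-l w r)) (trans (cong (swap w r) mr) (swap-o s≢w s≢r))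
      m′s : m′ s ≡ w
      m′s = trans (cong (swap w r ∘ m) (swap-o s≢w s≢r)) (trans (cong (swap w r) ms) (swap-r w r))
      keep : ∀ u → u ≢ x → u ≢ w → u ≢ s → u ≢ r → m′ u ≡ m u
      keep u u≢x u≢w u≢s u≢r = trans (cong (swap w r ∘ m) (swap-o u≢w u≢r))
        (swap-o (λ e → u≢x (trans (sym (inv u)) (trans (cong m e) mw)))
                (λ e → u≢s (trans (sym (inv u)) (trans (cong m e) mr))))
      ok′ : ∀ u → u ≢ x → u ≢ r → R u (m′ u)
      ok′ u u≢x u≢r = by-cases (u ≟ w) (u ≟ s)
        where
        by-cases : Dec (u ≡ w) → Dec (u ≡ s) → R u (m′ u)
        by-cases (yes refl) _ = subst (R u) (sym m′w) ws
        by-cases (no _) (yes refl) = subst (R u) (sym m′s) (R-sym ws)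
        by-cases (no u≢w) (no u≢s) = subst (R u) (sym (keep u u≢x u≢w u≢s u≢r)) (ok u u≢x u≢w u≢s u≢r)

    module _ (R-sym : Symmetric R) (R-irr : ∀ {u} → ¬ R u u) where

      -- One step of an alternating walk: w takes its neighbour z, and the former mate of z becomes
      -- the new end of the deficient pair.
      rotate : ∀ {x w z} (N : Near R x w) → x ≢ w → R w z → z ≢ x →
        Σ (Near R x (Near.mate N z)) λ N′ →
          ∀ u → u ≢ x → u ≢ w → u ≢ z → u ≢ Near.mate N z → Near.mate N′ u ≡ Near.mate N u
      rotate {x} {w} {z} N x≢w wz z≢x = exchange R-sym mate involutive at refl
          (λ u u≢x u≢w _ _ → ok u u≢x u≢w) x≢w
          (λ e → R-irr (subst (R z) (sym e) (ok z z≢x z≢w))) z≢x z≢w wz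
        where
        open Near N
        z≢w : z ≢ w
        z≢w refl = R-irr wz

      -- A rotation through the mate of w′ ends in w′. If w′ is w already, no rotation is made, so
      -- adjacency is asked for only in the other case.
      retarget : ∀ {x w w′} (N : Near R x w) → x ≢ w → x ≢ w′ → (w′ ≢ w → R w (Near.mate N w′)) →
        Σ (Near R x w′) λ N′ →
          ∀ u → u ≢ x → u ≢ w → u ≢ Near.mate N w′ → u ≢ w′ → Near.mate N′ u ≡ Near.mate N u
      retarget {x} {w} {w′} N x≢w x≢w′ r with w′ ≟ w
      ... | yes refl = N , λ _ _ _ _ _ → refl
      ... | no w′≢w = subst (λ v → Σ (Near R x v) λ N′ →
              ∀ u → u ≢ x → u ≢ w → u ≢ mate w′ → u ≢ v → Near.mate N′ u ≡ mate u)
            (involutive w′) (rotate N x≢w (r w′≢w) λ eq → w′≢w (trans (sym (involutive w′)) (trans (cong mate eq) at)))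
        where open Near N

    perfect-near : (P : Perfect R) → ∀ x → Near R x (Perfect.mate P x)
    perfect-near P x = record { mate = mate ; involutive = involutive ; at = refl ; ok = λ u _ _ → ok u }
      where open Perfect P

-- 1-factorizations and families of faulty edges.

record Factorization {V : Set} (R : V → V → Set) (d : ℕ) : Set where
  field
    mate : Fin d → V → V
    involutive : ∀ c u → mate c (mate c u) ≡ u
    ok : ∀ c u → R u (mate c u)
    complete : ∀ {u v} → R u v → ∃ λ c → mate c u ≡ v
    injective : ∀ {c c′} u → mate c u ≡ mate c′ u → c ≡ c′

Avoids : ∀ {V : Set} {ℓ} → (Fin ℓ → V × V) → V → V → Set
Avoids f u v = ∀ s → f s ≢ (u , v) × f s ≢ (v , u)

_∖_ : ∀ {V : Set} {ℓ} → (V → V → Set) → (Fin ℓ → V × V) → V → V → Set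
(R ∖ f) u v = R u v × Avoids f u v

module Colouring {V : Set} (_≟_ : DecidableEquality V) {R : V → V → Set} {d : ℕ} (𝓕 : Factorization R d) where
  open Factorization 𝓕
  open Matching _≟_ using (Perfect)

  -- v ≡ mate c u iff u ≡ mate c v, so the orientation of the pair is immaterial.
  HasColour : Fin d → V × V → Set
  HasColour c e = proj₂ e ≡ mate c (proj₁ e)

  hasColour? : ∀ c e → Dec (HasColour c e)
  hasColour? c e = proj₂ e ≟ mate c (proj₁ e)

  colour-unique : ∀ {c c′ e} → HasColour c e → HasColour c′ e → c ≡ c′
  colour-unique h h′ = injective _ (trans (sym h) h′)

  hasColour-intro : ∀ {c e u v} → v ≡ mate c u → e ≡ (u , v) ⊎ e ≡ (v , u) → HasColour c e
  hasColour-intro h (inj₁ refl) = h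
  hasColour-intro {c} refl (inj₂ refl) = sym (involutive c _)

  -- A fault equal to the edge from u to `mate c u` has colour c, so only the faults of that colour
  -- have to be examined.
  avoids : ∀ {ℓ} {f : Fin ℓ → V × V} {c u} → (∀ s → HasColour c (f s) → f s ≢ (u , mate c u) × f s ≢ (mate c u , u)) →
    Avoids f u (mate c u)
  avoids h s = (λ e → proj₁ (h s (hasColour-intro refl (inj₁ e))) e) ,
               (λ e → proj₂ (h s (hasColour-intro refl (inj₂ e))) e)

  class : ∀ c → Perfect R
  class c = record { mate = mate c ; involutive = involutive c ; ok = ok c }

  unused⇒perfect : ∀ {ℓ} (f : Fin ℓ → V × V) c → (∀ s → ¬ HasColour c (f s)) → Perfect (R ∖ f)
  unused⇒perfect f c unused = record
    { mate = mate c ; involutive = involutive c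
    ; ok = λ u → ok c u , avoids λ s h → contradiction h (unused s) }

  colours-used : ∀ {ℓ} (f : Fin ℓ → V × V) → Perfect (R ∖ f) ⊎ (∀ c → ∃ λ s → HasColour c (f s))
  colours-used f with ∀-or-∃ {P = λ c → ∃ λ s → HasColour c (f s)} (λ c → ∃-or-∀ (λ s → hasColour? c (f s)))
  ... | inj₁ used = inj₂ used
  ... | inj₂ (c , unused) = inj₁ (unused⇒perfect f c unused)

  -- If every colour were hit, the pigeonhole principle would give one fault two colours. This is
  -- the lower bound for the matching preclusion number.
  few⇒perfect : ∀ {ℓ} (f : Fin ℓ → V × V) → ℓ < d → Perfect (R ∖ f)
  few⇒perfect f ℓ<d with colours-used f
  ... | inj₁ p = p
  ... | inj₂ used with pigeonhole ℓ<d (proj₁ ∘ used)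
  ... | c , c′ , c<c′ , eq = contradiction
          (colour-unique (proj₂ (used c)) (subst (λ s → HasColour c′ (f s)) (sym eq) (proj₂ (used c′))))
          (Fin.<⇒≢ c<c′)

-- One level of the recursive construction: copies and cross edges.

-- The vertex x of copy a is also described by its target copy punchIn a x.
module Pairs (T : ℕ) where

  V : Set
  V = Fin (suc T) × Fin T

  infix 4 _≟_
  _≟_ : DecidableEquality V
  _≟_ = ≡-dec Fin._≟_ Fin._≟_

  copy : V → Fin (suc T)
  copy = proj₁

  target : V → Fin (suc T)
  target (a , x) = punchIn a x

  target≢copy : ∀ u → target u ≢ copy u
  target≢copy (a , x) = punchInᵢ≢i a x

  -- The end in copy a of the unique cross edge between copies a and b.
  link : ∀ {a b : Fin (suc T)} → a ≢ b → V
  link {a} a≢b = a , punchOut a≢b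

  target-link : ∀ {a b} (a≢b : a ≢ b) → target (link a≢b) ≡ b
  target-link = punchIn-punchOut

  link-injective : ∀ {a b c : Fin (suc T)} (p : a ≢ b) (q : a ≢ c) → punchOut p ≡ punchOut q → b ≡ c
  link-injective p q eq = trans (sym (target-link p)) (trans (cong (punchIn _) eq) (target-link q))

  vertex-ext : ∀ {u v} → copy u ≡ copy v → target u ≡ target v → u ≡ v
  vertex-ext {a , x} {_ , y} refl eq = cong (a ,_) (punchIn-injective a x y eq)

  -- The matching formed by the cross edges: it reverses the ordered pair of copy and target.
  μ : V → V
  μ u = link (target≢copy u)

  target-μ : ∀ u → target (μ u) ≡ copy u
  target-μ u = target-link (target≢copy u)

  μ-involutive : ∀ u → μ (μ u) ≡ u
  μ-involutive u = vertex-ext (target-μ u) (target-μ (μ u))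

  μ≡ : ∀ {u v} → copy v ≡ target u → target v ≡ copy u → μ u ≡ v
  μ≡ {u} p q = vertex-ext (sym p) (trans (target-μ u) (sym q))

  μ-link : ∀ {a b} (a≢b : a ≢ b) (b≢a : b ≢ a) → μ (link a≢b) ≡ link b≢a
  μ-link a≢b b≢a = μ≡ (sym (target-link a≢b)) (target-link b≢a)

  open Matching _≟_

  data Step (E : Fin T → Fin T → Set) : V → V → Set where
    inner : ∀ {a x y} → E x y → Step E (a , x) (a , y)
    across : ∀ u → Step E u (μ u)

  inCopy : (V → V → Set) → Fin (suc T) → Fin T → Fin T → Set
  inCopy R a x y = R (a , x) (a , y)

  Internal : (V → V) → Fin (suc T) → Set
  Internal m a = ∀ x → copy (m (a , x)) ≡ a

  module _ {E : Fin T → Fin T → Set} (E-sym : Symmetric E) (E-irr : ∀ {x} → ¬ E x x) where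

    step-sym : Symmetric (Step E)
    step-sym (inner e) = inner (E-sym e)
    step-sym (across u) = subst (Step E (μ u)) (μ-involutive u) (across (μ u))

    step-irr : ∀ {u} → ¬ Step E u u
    step-irr = irr refl
      where
      irr : ∀ {u v} → u ≡ v → ¬ Step E u v
      irr u≡v (inner {x = x} e) = E-irr (subst (E x) (sym (cong proj₂ u≡v)) e)
      irr u≡v (across u) = target≢copy u (sym (cong copy u≡v))

    step-link : ∀ {a b} (a≢b : a ≢ b) (b≢a : b ≢ a) → Step E (link a≢b) (link b≢a)
    step-link a≢b b≢a = subst (Step E (link a≢b)) (μ-link a≢b b≢a) (across (link a≢b))

    step-factorization : ∀ {d} → Factorization E d → Factorization (Step E) (suc d)
    step-factorization {d} 𝓕 = record
      { mate = m ; involutive = inv ; ok = ok′ ; complete = comp ; injective = λ {c} {c′} → inj {c} {c′} }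
      where
      open Factorization 𝓕
      m : Fin (suc d) → V → V
      m zero u = μ u
      m (suc c) (a , x) = a , mate c x
      inv : ∀ c u → m c (m c u) ≡ u
      inv zero u = μ-involutive u
      inv (suc c) (a , x) = cong (a ,_) (involutive c x)
      ok′ : ∀ c u → Step E u (m c u)
      ok′ zero u = across u
      ok′ (suc c) (a , x) = inner (ok c x)
      comp : ∀ {u v} → Step E u v → ∃ λ c → m c u ≡ v
      comp (inner {a} e) = suc (proj₁ (complete e)) , cong (a ,_) (proj₂ (complete e))
      comp (across u) = zero , refl
      inj : ∀ {c c′} u → m c u ≡ m c′ u → c ≡ c′
      inj {zero} {zero} u _ = refl
      inj {zero} {suc _} u eq = contradiction (cong copy eq) (target≢copy u)
      inj {suc _} {zero} u eq = contradiction (sym (cong copy eq)) (target≢copy u)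
      inj {suc _} {suc _} (a , x) eq = cong suc (injective x (cong proj₂ eq))

  module Extend {R : V → V → Set} (R-sym : Symmetric R) where

    override : Fin (suc T) → (Fin T → Fin T) → (V → V) → V → V
    override b π m (a , x) with a Fin.≟ b
    ... | yes _ = a , π x
    ... | no _ = m (a , x)

    override-at : ∀ b π m x → override b π m (b , x) ≡ (b , π x)
    override-at b π m x with b Fin.≟ b
    ... | yes _ = refl
    ... | no b≢b = contradiction refl b≢b

    override-off : ∀ {b π m} u → copy u ≢ b → override b π m u ≡ m u
    override-off {b} (a , x) a≢b with a Fin.≟ b
    ... | yes a≡b = contradiction a≡b a≢b
    ... | no _ = refl

    module _ {m : V → V} (inv : ∀ u → m (m u) ≡ u) {b : Fin (suc T)} (int : Internal m b)
             {π : Fin T → Fin T} (π-inv : ∀ x → π (π x) ≡ x) where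

      -- The involution m maps copy b to itself, so nothing from outside can be sent into it.
      leaves : ∀ u → copy u ≢ b → copy (m u) ≢ b
      leaves u u≢b e = u≢b (trans (cong copy (trans (sym (inv u)) (cong m (vertex e)))) (int _))
        where
        vertex : ∀ {v} → copy v ≡ b → v ≡ (b , proj₂ v)
        vertex refl = refl

      override-involutive : ∀ u → override b π m (override b π m u) ≡ u
      override-involutive (a , x) = by-cases (a Fin.≟ b)
        where
        by-cases : Dec (a ≡ b) → override b π m (override b π m (a , x)) ≡ (a , x)
        by-cases (yes refl) = trans (cong (override b π m) (override-at b π m x))
          (trans (override-at b π m (π x)) (cong (b ,_) (π-inv x)))
        by-cases (no a≢b) = trans (cong (override b π m) (override-off _ a≢b))
          (trans (override-off _ (leaves _ a≢b)) (inv _))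

    -- Carries the deficient end from w into copy b: w is joined to (b , s), and a matching of copy
    -- b without s and r leaves (b , r) as the new end. The copies not involved stay internal, so
    -- the walk can later be led through them in the same way.
    override-near : ∀ {x w b} (N : Near R x w) → Internal (Near.mate N) b → copy x ≢ b → copy w ≢ b → x ≢ w →
      ∀ {s r} → Matching.Near Fin._≟_ (inCopy R b) s r → s ≢ r → R w (b , s) →
      Σ (Near R x (b , r)) λ N′ → ∀ {a} → a ≢ b → a ≢ copy x → a ≢ copy w →
        Internal (Near.mate N) a → Internal (Near.mate N′) a
    override-near {x} {w} {b} N int x∉b w∉b x≢w {s} {r} P s≢r ws =
      proj₁ new , λ {a} a≢b a≢x a≢w int-a y →
        trans (cong copy (trans (proj₂ new (a , y) (a≢x ∘ cong copy) (a≢w ∘ cong copy) (a≢b ∘ cong copy) (a≢b ∘ cong copy))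
                                (override-off _ a≢b)))
              (int-a y)
      where
      open Near N
      module P = Matching.Near P
      m′ = override b P.mate mate
      ok′ : ∀ u → u ≢ x → u ≢ w → u ≢ (b , s) → u ≢ (b , r) → R u (m′ u)
      ok′ (a , y) u≢x u≢w u≢s u≢r = by-cases (a Fin.≟ b)
        where
        by-cases : Dec (a ≡ b) → R (a , y) (m′ (a , y))
        by-cases (yes refl) = subst (R (b , y)) (sym (override-at b P.mate mate y))
          (P.ok y (u≢s ∘ cong (b ,_)) (u≢r ∘ cong (b ,_)))
        by-cases (no a≢b) = subst (R (a , y)) (sym (override-off _ a≢b)) (ok (a , y) u≢x u≢w)
      new = exchange R-sym m′ (override-involutive involutive int P.involutive)
        (trans (override-off x x∉b) at) (trans (override-at b P.mate mate s) (cong (b ,_) P.at)) ok′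
        x≢w (s≢r ∘ cong proj₂) (x∉b ∘ sym ∘ cong copy) (w∉b ∘ sym ∘ cong copy) ws

  module _ {E : Fin T → Fin T → Set} (E-sym : Symmetric E) (E-irr : ∀ {x} → ¬ E x x)
           {d : ℕ} (𝓕 : Factorization E d) (c₀ : Fin d) where

    private
      module F = Factorization 𝓕
      𝓖 = step-factorization E-sym E-irr 𝓕
      module G = Factorization 𝓖

    -- All other copies are matched by the colour c₀, so no pair leaves its copy.
    step-near-inner : ∀ a {x y} → Matching.Near Fin._≟_ E x y → Σ (Near (Step E) (a , x) (a , y)) λ N →
      ∀ b → Internal (Near.mate N) b
    step-near-inner a {x} {y} P = record
      { mate = m′ ; involutive = override-involutive inv (λ _ → refl) P.involutive
      ; at = trans (override-at a P.mate m x) (cong (a ,_) P.at) ; ok = ok′ } , int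
      where
      open Extend {Step E} (step-sym E-sym E-irr)
      module P = Matching.Near P
      m = G.mate (suc c₀)
      inv = G.involutive (suc c₀)
      m′ = override a P.mate m
      ok′ : ∀ u → u ≢ (a , x) → u ≢ (a , y) → Step E u (m′ u)
      ok′ (b , z) u≢x u≢y = by-cases (b Fin.≟ a)
        where
        by-cases : Dec (b ≡ a) → Step E (b , z) (m′ (b , z))
        by-cases (yes refl) = subst (Step E (a , z)) (sym (override-at a P.mate m z))
          (inner (P.ok z (u≢x ∘ cong (a ,_)) (u≢y ∘ cong (a ,_))))
        by-cases (no b≢a) = subst (Step E (b , z)) (sym (override-off _ b≢a)) (inner (F.ok c₀ z))
      int : ∀ b → Internal m′ b
      int b z = by-cases (b Fin.≟ a)
        where
        by-cases : Dec (b ≡ a) → copy (m′ (b , z)) ≡ b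
        by-cases (yes refl) = cong copy (override-at a P.mate m z)
        by-cases (no b≢a) = cong copy (override-off {a} {P.mate} {m} (b , z) b≢a)

    -- Ends in distinct copies p and q are connected through a third copy c: from x to the link
    -- towards c, through c to its link towards q, and within q to y. Each of the three copies loses
    -- two vertices and is completed by bicriticality.
    step-bicritical : 4 ≤ T → Matching.Bicritical Fin._≟_ E → Bicritical (Step E)
    step-bicritical 4≤T bic (p , x) (q , y) u≢v with p Fin.≟ q
    ... | yes refl = proj₁ (step-near-inner p (bic x y (u≢v ∘ cong (p ,_))))
    -- Excluding the targets of both ends makes the links of p and q towards c differ from x and y.
    -- Four excluded copies out of T + 1 account for `4 ≤ T`.
    ... | no p≢q with fresh (p ∷ q ∷ punchIn p x ∷ punchIn q y ∷ []) (s≤s 4≤T)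
    ... | c , c≢p ∷ c≢q ∷ c≢x° ∷ c≢y° ∷ [] = proj₁ N₂
      where
      open Extend {Step E} (step-sym E-sym E-irr)
      near : ∀ {a s r} → s ≢ r → Matching.Near Fin._≟_ (inCopy (Step E) a) s r
      near s≢r = record { mate = B.mate ; involutive = B.involutive ; at = B.at ; ok = λ u u≢s u≢r → inner (B.ok u u≢s u≢r) }
        where module B = Matching.Near (bic _ _ s≢r)
      p≢c = c≢p ∘ sym
      q≢c = c≢q ∘ sym
      x≢pc : x ≢ punchOut p≢c
      x≢pc refl = c≢x° (sym (target-link p≢c))
      qc≢y : punchOut q≢c ≢ y
      qc≢y refl = c≢y° (sym (target-link q≢c))
      cp≢cq : punchOut c≢p ≢ punchOut c≢q
      cp≢cq = p≢q ∘ link-injective c≢p c≢q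
      N₀ = step-near-inner p (bic x (punchOut p≢c) x≢pc)
      N₁ = override-near (proj₁ N₀) (proj₂ N₀ c) p≢c p≢c (x≢pc ∘ cong proj₂) (near cp≢cq) cp≢cq (step-link E-sym E-irr p≢c c≢p)
      N₂ = override-near (proj₁ N₁) (proj₂ N₁ q≢c (p≢q ∘ sym) (p≢q ∘ sym) (proj₂ N₀ q)) p≢q c≢q (p≢c ∘ cong copy)
             (near qc≢y) qc≢y (step-link E-sym E-irr c≢q q≢c)

-- Fault families as large as the degree, and stars as the trivial ones.

Star : ∀ {V : Set} {ℓ} → (V → V → Set) → (Fin ℓ → V × V) → Set
Star R f = ∃ λ z → (∀ s → proj₁ (f s) ≡ z ⊎ proj₂ (f s) ≡ z)
                 × (∀ {u} → R z u → ∃ λ s → f s ≡ (z , u) ⊎ f s ≡ (u , z))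

perfect-map : ∀ {V : Set} {_≟_ : DecidableEquality V} {R S : V → V → Set} → (∀ {u v} → R u v → S u v) →
  Matching.Perfect _≟_ R → Matching.Perfect _≟_ S
perfect-map R⊆S P = record { mate = mate ; involutive = involutive ; ok = R⊆S ∘ ok }
  where open Matching.Perfect P

module Faults {T d : ℕ} {E : Fin T → Fin T → Set} (E-sym : Symmetric E) (E-irr : ∀ {x} → ¬ E x x)
              (𝓕 : Factorization E d) where

  open Pairs T
  open Matching _≟_

  private
    module F = Factorization 𝓕

  𝓖 : Factorization (Step E) (suc d)
  𝓖 = step-factorization E-sym E-irr 𝓕

  private
    module G = Factorization 𝓖
  open Colouring _≟_ 𝓖

  -- What certainly survives the faults in the critical case: one edge of each colour
  -- is faulty in copy i, the one of colour c being at x, and a cross edge at u survives if Q u.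
  data Spared (i : Fin (suc T)) (c : Fin d) (x : Fin T) (Q : V → Set) : V → V → Set where
    inner  : ∀ {a y z} → a ≢ i → E y z → Spared i c x Q (a , y) (a , z)
    colour : ∀ {u} → u ≢ (i , x) → u ≢ (i , F.mate c x) → Spared i c x Q u (G.mate (suc c) u)
    across : ∀ {u} → Q u → Spared i c x Q u (μ u)

  OffCrossEdge : V → V → Set
  OffCrossEdge e u = u ≢ e × u ≢ μ e

  -- The critical case with a fault of copy i, of colour c, disjoint from the faulty cross edge e.
  -- It is kept as a separate property because over the hexagon it comes from a search instead of
  -- bicriticality.
  Bypass : Set
  Bypass = ∀ i c x e → (i , x) ≢ e → (i , x) ≢ μ e → (i , F.mate c x) ≢ e → (i , F.mate c x) ≢ μ e →
    Perfect (Spared i c x (OffCrossEdge e))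

  ≢-μ : ∀ {u v} → u ≢ μ v → μ u ≢ v
  ≢-μ u≢ eq = u≢ (trans (sym (μ-involutive _)) (cong μ eq))

  offCrossEdge-μ : ∀ {e u} → OffCrossEdge e u → OffCrossEdge e (μ u)
  offCrossEdge-μ {e} {u} (u≢e , u≢μe) = ≢-μ u≢μe , ≢-μ (subst (u ≢_) (sym (μ-involutive e)) u≢e)

  near-spared : ∀ {i c x Q} → Near (Spared i c x Q) (i , x) (i , F.mate c x)
  near-spared {c = c} = record { mate = G.mate (suc c) ; involutive = G.involutive (suc c) ; at = refl ; ok = λ u → colour }

  module _ {i : Fin (suc T)} {c : Fin d} {x : Fin T} {Q : V → Set} where

    ≢-mate : ∀ {u y} → u ≢ (i , F.mate c y) → G.mate (suc c) u ≢ (i , y)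
    ≢-mate u≢ eq = u≢ (trans (sym (G.involutive (suc c) _)) (cong (G.mate (suc c)) eq))

    spared-sym : (∀ {u} → Q u → Q (μ u)) → Symmetric (Spared i c x Q)
    spared-sym Q-μ (inner a≢i yz) = inner a≢i (E-sym yz)
    spared-sym Q-μ (colour {u} u≢x u≢y) = subst (Spared i c x Q _) (G.involutive (suc c) u)
      (colour (≢-mate u≢y) (≢-mate (subst (λ y → u ≢ (i , y)) (sym (F.involutive c x)) u≢x)))
    spared-sym Q-μ (across {u} q) = subst (Spared i c x Q (μ u)) (μ-involutive u) (across (Q-μ q))

    spared⇒step : ∀ {u v} → Spared i c x Q u v → Step E u v
    spared⇒step (inner _ yz) = inner yz
    spared⇒step (colour {u} _ _) = G.ok (suc c) u
    spared⇒step (across {u} _) = across u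

  -- The cycle of copies is i, l, m, j, where l and j are the targets of y and x. The deficient end
  -- leaves i at y and arrives in j at the other end of the cross edge of x, which closes the
  -- matching.
  bicritical⇒bypass : 5 ≤ T → Matching.Bicritical Fin._≟_ E → Bypass
  bicritical⇒bypass 5≤T bic i c x e x≢e x≢μe y≢e y≢μe
    -- The copy m must differ from i, j and l to give a cycle of four, and from both copies met by e
    -- to keep its cross edges sound. These five exclusions account for `5 ≤ T`.
    with fresh (i ∷ target (i , x) ∷ target (i , F.mate c x) ∷ copy e ∷ target e ∷ []) (s≤s 5≤T)
  ... | m , m≢i ∷ m≢j ∷ m≢l ∷ m≢e ∷ m≢μe ∷ [] = close R-sym (proj₁ N₃) (across (x≢e , x≢μe))
    where
    R = Spared i c x (OffCrossEdge e)
    R-sym : Symmetric R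
    R-sym = spared-sym offCrossEdge-μ
    open Extend {R} R-sym
    y = F.mate c x
    x≢y : x ≢ y
    x≢y eq = E-irr (subst (E x) (sym eq) (F.ok c x))
    j = target (i , x)
    l = target (i , y)
    j≢l : j ≢ l
    j≢l = x≢y ∘ punchIn-injective i x y
    near : ∀ {a s r} → a ≢ i → s ≢ r → Matching.Near Fin._≟_ (inCopy R a) s r
    near a≢i s≢r = record { mate = B.mate ; involutive = B.involutive ; at = B.at ; ok = λ u u≢s u≢r → inner a≢i (B.ok u u≢s u≢r) }
      where module B = Matching.Near (bic _ _ s≢r)
    -- Both ends of e lie in copies other than m, so no cross edge at m is e.
    m-link : ∀ {a} (a≢m : a ≢ m) (m≢a : m ≢ a) → R (link a≢m) (link m≢a)
    m-link a≢m m≢a = subst (R (link a≢m)) (μ-link a≢m m≢a)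
      (across ((λ eq → m≢μe (trans (sym (target-link a≢m)) (cong target eq))) ,
               (λ eq → m≢e (trans (sym (target-link a≢m)) (trans (cong target eq) (target-μ e))))))
    l≢i : l ≢ i
    l≢i = target≢copy (i , y)
    j≢i : j ≢ i
    j≢i = target≢copy (i , x)
    s₁≢r₁ : punchOut l≢i ≢ punchOut (m≢l ∘ sym)
    s₁≢r₁ = m≢i ∘ sym ∘ link-injective l≢i (m≢l ∘ sym)
    s₂≢r₂ : punchOut m≢l ≢ punchOut m≢j
    s₂≢r₂ = j≢l ∘ sym ∘ link-injective m≢l m≢j
    s₃≢r₃ : punchOut (m≢j ∘ sym) ≢ punchOut j≢i
    s₃≢r₃ = m≢i ∘ link-injective (m≢j ∘ sym) j≢i
    N₁ = override-near {x = i , x} {i , y} {l} near-spared (λ _ → refl) (l≢i ∘ sym) (l≢i ∘ sym) (x≢y ∘ cong proj₂)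
           (near l≢i s₁≢r₁) s₁≢r₁ (across (y≢e , y≢μe))
    N₂ = override-near {b = m} (proj₁ N₁) (proj₂ N₁ m≢l m≢i m≢i (λ _ → refl)) (m≢i ∘ sym) (m≢l ∘ sym) (l≢i ∘ sym ∘ cong copy)
           (near m≢i s₂≢r₂) s₂≢r₂ (m-link (m≢l ∘ sym) m≢l)
    N₃ = override-near {b = j} (proj₁ N₂) (proj₂ N₂ (m≢j ∘ sym) j≢i j≢l (proj₂ N₁ j≢l j≢i j≢i (λ _ → refl)))
           (j≢i ∘ sym) m≢j (m≢i ∘ sym ∘ cong copy)
           (near j≢i s₃≢r₃) s₃≢r₃ (R-sym (m-link (m≢j ∘ sym) m≢j))

  module _ (bypass : Bypass) (f : Fin (suc d) → V × V) where

    private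
      -- An edge of positive colour has both ends in one copy, so the copy of its first end locates
      -- it.
      FaultIn : Fin (suc T) → Fin d → Fin (suc d) → Set
      FaultIn a c s = copy (proj₁ (f s)) ≡ a × HasColour (suc c) (f s)

      faultIn? : ∀ a c s → Dec (FaultIn a c s)
      faultIn? a c s = (copy (proj₁ (f s)) Fin.≟ a) ×-dec hasColour? (suc c) (f s)

    -- Positive colours preserve every copy, so the colour may be chosen independently in each of
    -- them.
    free-colours⇒perfect : (∀ a → ∃ λ c → ∀ s → ¬ FaultIn a c s) → Perfect (Step E ∖ f)
    free-colours⇒perfect free = record
      { mate = λ u → G.mate (colour-at u) u
      ; involutive = λ u → G.involutive (colour-at u) u
      ; ok = λ u → G.ok (colour-at u) u , avoids {c = colour-at u} λ s h →
          (λ eq → proj₂ (free (copy u)) s (cong (copy ∘ proj₁) eq , h)) ,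
          (λ eq → proj₂ (free (copy u)) s (cong (copy ∘ proj₁) eq , h)) }
      where
      colour-at : V → Fin (suc d)
      colour-at u = suc (proj₁ (free (copy u)))

    module Critical (i : Fin (suc T)) (used : ∀ c → ∃ (FaultIn i c)) (s₀ : Fin (suc d)) (h₀ : HasColour zero (f s₀)) where

      fault : Fin (suc d) → Fin (suc d)
      fault zero = s₀
      fault (suc c) = proj₁ (used c)

      fault-colour : ∀ c → HasColour c (f (fault c))
      fault-colour zero = h₀
      fault-colour (suc c) = proj₂ (proj₂ (used c))

      -- A fault has at most one colour, so `fault` is injective; d + 1 colours then exhaust the d +
      -- 1 faults, and each colour has exactly one.
      fault-surjective : ∀ s → ∃ λ c → fault c ≡ s
      fault-surjective = injective⇒surjective fault λ {c} {c′} eq →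
        colour-unique (fault-colour c) (subst (λ s → HasColour c′ (f s)) (sym eq) (fault-colour c′))

      of-colour : ∀ {c s} → HasColour c (f s) → fault c ≡ s
      of-colour {c} {s} h with fault-surjective s
      ... | c′ , refl = cong fault (colour-unique h (fault-colour c′))

      e : V
      e = proj₁ (f s₀)

      end : Fin d → Fin T
      end c = proj₂ (proj₁ (f (fault (suc c))))

      fault-inner : ∀ c → f (fault (suc c)) ≡ ((i , end c) , (i , F.mate c (end c)))
      fault-inner c with f (fault (suc c)) | proj₂ (used c)
      ... | (_ , y) , _ | refl , refl = refl

      fault-cross : f (fault zero) ≡ (e , μ e)
      fault-cross = cong (e ,_) h₀

      -- All faults are known by now: e and one edge of each positive colour inside copy i. Hence
      -- other copies are sound, colour c is damaged only at `end c`, and the only faulty cross edge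
      -- is e.
      spared⇒avoids : ∀ {c u v} → Spared i c (end c) (OffCrossEdge e) u v → (Step E ∖ f) u v
      spared⇒avoids (inner {a} {y} {z} a≢i yz) = inner yz , av
        where
        no-fault : ∀ {y z} s → f s ≢ ((a , y) , (a , z))
        no-fault s eq with fault-surjective s
        ... | zero , refl = target≢copy e (trans (cong (copy ∘ proj₂) e≡) (sym (cong (copy ∘ proj₁) e≡)))
          where e≡ = trans (sym fault-cross) eq
        ... | suc c , refl = a≢i (cong (copy ∘ proj₁) (trans (sym eq) (fault-inner c)))
        av : Avoids f (a , y) (a , z)
        av s = no-fault s , no-fault s
      spared⇒avoids {c} (colour {u} u≢x u≢y) = G.ok (suc c) u , avoids {c = suc c} λ s h →
          (λ eq → u≢x (cong proj₁ (trans (sym eq) (is h)))) ,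
          (λ eq → u≢y (cong proj₂ (trans (sym eq) (is h))))
        where
        is : ∀ {s} → HasColour (suc c) (f s) → f s ≡ ((i , end c) , (i , F.mate c (end c)))
        is h = trans (cong f (sym (of-colour h))) (fault-inner c)
      spared⇒avoids (across {u} (u≢e , u≢μe)) = across u , avoids {c = zero} λ s h →
          (λ eq → u≢e (cong proj₁ (trans (sym eq) (is h)))) ,
          (λ eq → u≢μe (cong proj₂ (trans (sym eq) (is h))))
        where
        is : ∀ {s} → HasColour zero (f s) → f s ≡ (e , μ e)
        is h = trans (cong f (sym (of-colour {zero} h))) fault-cross

      _∈ᵉ_ : V → V × V → Set
      z ∈ᵉ e′ = proj₁ e′ ≡ z ⊎ proj₂ e′ ≡ z

      -- Every edge at z has some colour, and the fault of that colour, having z as an end, is this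
      -- edge.
      common-end⇒star : ∀ z → (∀ c → z ∈ᵉ f (fault c)) → Star (Step E) f
      common-end⇒star z all-z = z , all-z′ , star
        where
        all-z′ : ∀ s → z ∈ᵉ f s
        all-z′ s with fault-surjective s
        ... | c , refl = all-z c
        star : ∀ {u} → Step E z u → ∃ λ s → f s ≡ (z , u) ⊎ f s ≡ (u , z)
        star zu with G.complete zu
        ... | c , refl = fault c , oriented (all-z c) (fault-colour c)
          where
          oriented : ∀ {e′} → z ∈ᵉ e′ → HasColour c e′ → e′ ≡ (z , G.mate c z) ⊎ e′ ≡ (G.mate c z , z)
          oriented (inj₁ refl) refl = inj₁ refl
          oriented {v , _} (inj₂ refl) refl = inj₂ (cong (_, G.mate c v) (sym (G.involutive c v)))

      Touches : Fin d → Set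
      Touches c = (i , end c) ≡ e ⊎ (i , end c) ≡ μ e ⊎ (i , F.mate c (end c)) ≡ e ⊎ (i , F.mate c (end c)) ≡ μ e

      touches? : ∀ c → Dec (Touches c)
      touches? c = (_ ≟ e) ⊎-dec (_ ≟ μ e) ⊎-dec (_ ≟ e) ⊎-dec (_ ≟ μ e)

      -- Faults inside copy i can only meet the end of the faulty cross edge lying in copy i.
      all-touch⇒star : (∀ c → Touches c) → Star (Step E) f
      all-touch⇒star touch with copy e Fin.≟ i
      ... | yes e∈i = common-end⇒star e λ
              { zero → inj₁ refl
              ; (suc c) → subst (e ∈ᵉ_) (sym (fault-inner c)) (pick (touch c)) }
        where
        no-μ : ∀ {y} → (i , y) ≢ μ e
        no-μ eq = target≢copy e (trans (sym (cong copy eq)) (sym e∈i))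
        pick : ∀ {c} → Touches c → e ∈ᵉ ((i , end c) , (i , F.mate c (end c)))
        pick (inj₁ eq) = inj₁ eq
        pick (inj₂ (inj₁ eq)) = contradiction eq no-μ
        pick (inj₂ (inj₂ (inj₁ eq))) = inj₂ eq
        pick (inj₂ (inj₂ (inj₂ eq))) = contradiction eq no-μ
      ... | no e∉i = common-end⇒star (μ e) λ
              { zero → inj₂ (cong proj₂ fault-cross)
              ; (suc c) → subst (μ e ∈ᵉ_) (sym (fault-inner c)) (pick (touch c)) }
        where
        no-e : ∀ {y} → (i , y) ≢ e
        no-e eq = e∉i (sym (cong copy eq))
        pick : ∀ {c} → Touches c → μ e ∈ᵉ ((i , end c) , (i , F.mate c (end c)))
        pick (inj₁ eq) = contradiction eq no-e
        pick (inj₂ (inj₁ eq)) = inj₁ eq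
        pick (inj₂ (inj₂ (inj₁ eq))) = contradiction eq no-e
        pick (inj₂ (inj₂ (inj₂ eq))) = inj₂ eq

      critical : Perfect (Step E ∖ f) ⊎ Star (Step E) f
      critical with ∀-or-∃ {P = Touches} {Q = λ c → ¬ Touches c} (λ c → dec⇒⊎ (touches? c))
        where
        dec⇒⊎ : ∀ {P : Set} → Dec P → P ⊎ ¬ P
        dec⇒⊎ (yes p) = inj₁ p
        dec⇒⊎ (no ¬p) = inj₂ ¬p
      ... | inj₁ touch = inj₂ (all-touch⇒star touch)
      ... | inj₂ (c , ¬touch) = inj₁ (perfect-map spared⇒avoids (bypass i c (end c) e
              (¬touch ∘ inj₁) (¬touch ∘ inj₂ ∘ inj₁) (¬touch ∘ inj₂ ∘ inj₂ ∘ inj₁) (¬touch ∘ inj₂ ∘ inj₂ ∘ inj₂)))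

    perfect-or-star : Perfect (Step E ∖ f) ⊎ Star (Step E) f
    perfect-or-star with ∀-or-∃ {P = λ a → ∃ λ c → ∀ s → ¬ FaultIn a c s} {Q = λ a → ∀ c → ∃ (FaultIn a c)} colour-in
      where
      colour-in : ∀ a → (∃ λ c → ∀ s → ¬ FaultIn a c s) ⊎ (∀ c → ∃ (FaultIn a c))
      colour-in a = Sum.swap (∀-or-∃ λ c → ∃-or-∀ (faultIn? a c))
    ... | inj₁ free = inj₁ (free-colours⇒perfect free)
    ... | inj₂ (i , used) with colours-used f
    ... | inj₁ p = inj₁ p
    ... | inj₂ hit = Critical.critical i used (proj₁ (hit zero)) (proj₂ (hit zero))

-- Transport along graph isomorphisms.

record _≅_ {V W : Set} (R : V → V → Set) (S : W → W → Set) : Set where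
  field
    to : V → W
    from : W → V
    to-from : ∀ w → to (from w) ≡ w
    from-to : ∀ v → from (to v) ≡ v
    preserves : ∀ {u v} → R u v → S (to u) (to v)
    reflects : ∀ {w w′} → S w w′ → R (from w) (from w′)

module Transport {V W : Set} {_≟ᵛ_ : DecidableEquality V} {_≟ʷ_ : DecidableEquality W}
                 {R : V → V → Set} {S : W → W → Set} (I : R ≅ S) where
  open _≅_ I
  private
    module MV = Matching _≟ᵛ_
    module MW = Matching _≟ʷ_

  preserves′ : ∀ {w v} → R (from w) v → S w (to v)
  preserves′ r = subst (λ w → S w _) (to-from _) (preserves r)

  sym-transport : Symmetric R → Symmetric S
  sym-transport R-sym s = subst (S _) (to-from _) (preserves′ (R-sym (reflects s)))

  irr-transport : (∀ {v} → ¬ R v v) → ∀ {w} → ¬ S w w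
  irr-transport R-irr s = R-irr (reflects s)

  conjugate : (V → V) → W → W
  conjugate m = to ∘ m ∘ from

  conjugate-involutive : ∀ m → (∀ v → m (m v) ≡ v) → ∀ w → conjugate m (conjugate m w) ≡ w
  conjugate-involutive m inv w = trans (cong (to ∘ m) (from-to _)) (trans (cong to (inv _)) (to-from w))

  to-injective : ∀ {u v} → to u ≡ to v → u ≡ v
  to-injective eq = trans (sym (from-to _)) (trans (cong from eq) (from-to _))

  from-≡ : ∀ {w v} → from w ≡ v → w ≡ to v
  from-≡ eq = trans (sym (to-from _)) (cong to eq)

  factorization-transport : ∀ {d} → Factorization R d → Factorization S d
  factorization-transport 𝓕 = record
    { mate = λ c → conjugate (mate c)
    ; involutive = λ c → conjugate-involutive (mate c) (involutive c)
    ; ok = λ c w → preserves′ (ok c (from w))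
    ; complete = λ s → proj₁ (complete (reflects s)) , trans (cong to (proj₂ (complete (reflects s)))) (to-from _)
    ; injective = λ w → injective (from w) ∘ to-injective }
    where open Factorization 𝓕

  bicritical-transport : MV.Bicritical R → MW.Bicritical S
  bicritical-transport bic x w x≢w = record
    { mate = conjugate mate ; involutive = conjugate-involutive mate involutive
    ; at = trans (cong to at) (to-from w)
    ; ok = λ u u≢x u≢w → preserves′ (ok (from u) (u≢x ∘ from-injective) (u≢w ∘ from-injective)) }
    where
    from-injective : ∀ {w w′} → from w ≡ from w′ → w ≡ w′
    from-injective eq = trans (from-≡ eq) (to-from _)
    open MV.Near (bic (from x) (from w) (x≢w ∘ from-injective))

  module _ {ℓ : ℕ} (f : Fin ℓ → W × W) where

    pullback : Fin ℓ → V × V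
    pullback s = from (proj₁ (f s)) , from (proj₂ (f s))

    perfect-transport : MV.Perfect (R ∖ pullback) → MW.Perfect (S ∖ f)
    perfect-transport P = record
      { mate = conjugate mate ; involutive = conjugate-involutive mate involutive
      ; ok = λ w → preserves′ (proj₁ (ok (from w))) , λ s →
          (λ eq → proj₁ (proj₂ (ok (from w)) s) (trans (pull eq) (cong (from w ,_) (from-to _)))) ,
          (λ eq → proj₂ (proj₂ (ok (from w)) s) (trans (pull eq) (cong (_, from w) (from-to _)))) }
      where
      open MV.Perfect P
      pull : ∀ {s e} → f s ≡ e → pullback s ≡ (from (proj₁ e) , from (proj₂ e))
      pull eq = cong (λ e → from (proj₁ e) , from (proj₂ e)) eq

    star-transport : Star R pullback → Star S f
    star-transport (z , at-z , all) = to z , (λ s → Sum.map from-≡ from-≡ (at-z s)) , star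
      where
      push : ∀ {s u v} → pullback s ≡ (u , v) → f s ≡ (to u , to v)
      push eq = cong₂ _,_ (from-≡ (cong proj₁ eq)) (from-≡ (cong proj₂ eq))
      star : ∀ {w} → S (to z) w → ∃ λ s → f s ≡ (to z , w) ⊎ f s ≡ (w , to z)
      star {w} zw with all (subst (λ u → R u (from w)) (from-to z) (reflects zw))
      ... | s , eq = s , Sum.map (λ e → trans (push e) (cong (to z ,_) (to-from w)))
                                 (λ e → trans (push e) (cong (_, to z) (to-from w))) eq

-- The numerical rule for cross edges agrees with `μ`.

toℕ-punchIn-< : ∀ {n} (a : Fin (suc n)) (x : Fin n) → toℕ x < toℕ a → toℕ (punchIn a x) ≡ toℕ x
toℕ-punchIn-< (suc a) zero _ = refl
toℕ-punchIn-< (suc a) (suc x) (s≤s lt) = cong suc (toℕ-punchIn-< a x lt)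

toℕ-punchIn-≥ : ∀ {n} (a : Fin (suc n)) (x : Fin n) → toℕ a ≤ toℕ x → toℕ (punchIn a x) ≡ suc (toℕ x)
toℕ-punchIn-≥ zero x _ = refl
toℕ-punchIn-≥ (suc a) (suc x) (s≤s le) = cong suc (toℕ-punchIn-≥ a x le)

module _ {T : ℕ} where
  open Pairs T

  Cross : V → V → Set
  Cross (a , x) (b , y) = cross (toℕ a) (toℕ x) (toℕ b) (toℕ y) ≡ true

  private
    open Equivalence

    ≡true⇒T : ∀ {b} → b ≡ true → Bool.T b
    ≡true⇒T = from T-≡

    T⇒≡true : ∀ {b} → Bool.T b → b ≡ true
    T⇒≡true = to T-≡

  -- As a < b, the uid b - 1 lies at or above a and `punchIn` raises it to b, while the uid a lies
  -- below b and is kept. So each end has the copy of the other as its target.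
  Cross⇒μ : ∀ {u v} → Cross u v → μ u ≡ v
  Cross⇒μ {a , x} {b , y} h with to (T-∧ {toℕ a <ᵇ toℕ b}) (≡true⇒T h)
  ... | a<ᵇb , h′ with to (T-∧ {toℕ x ≡ᵇ (toℕ b ∸ 1)}) h′
  ... | x≡ᵇ , y≡ᵇ = μ≡ (toℕ-injective (sym target-u)) (toℕ-injective target-v)
    where
    a<b = <ᵇ⇒< (toℕ a) (toℕ b) a<ᵇb
    x≡ : suc (toℕ x) ≡ toℕ b
    x≡ = trans (cong suc (≡ᵇ⇒≡ (toℕ x) (toℕ b ∸ 1) x≡ᵇ)) (ℕ.m+[n∸m]≡n (ℕ.≤-trans (s≤s z≤n) a<b))
    y≡ : toℕ y ≡ toℕ a
    y≡ = ≡ᵇ⇒≡ (toℕ y) (toℕ a) y≡ᵇ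
    target-u : toℕ (target (a , x)) ≡ toℕ b
    target-u = trans (toℕ-punchIn-≥ a x (ℕ.≤-pred (subst (toℕ a <_) (sym x≡) a<b))) x≡
    target-v : toℕ (target (b , y)) ≡ toℕ a
    target-v = trans (toℕ-punchIn-< b y (subst (_< toℕ b) (sym y≡) a<b)) y≡

  target⇒Cross : ∀ {u v} → target u ≡ copy v → target v ≡ copy u → toℕ (copy u) < toℕ (copy v) → Cross u v
  target⇒Cross {a , x} {b , y} p q a<b = T⇒≡true (from T-∧ (<⇒<ᵇ a<b ,
      from T-∧ (≡⇒≡ᵇ (toℕ x) (toℕ b ∸ 1) (cong (_∸ 1) x≡) , ≡⇒≡ᵇ (toℕ y) (toℕ a) y≡)))
    where
    p′ = cong toℕ p
    q′ = cong toℕ q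
    x≡ : suc (toℕ x) ≡ toℕ b
    x≡ with ℕ.<-≤-connex (toℕ x) (toℕ a)
    -- Were x below a, the target b would be x itself, against a < b.
    ... | inj₁ x<a = contradiction (ℕ.<-trans (subst (_< toℕ a) (trans (sym (toℕ-punchIn-< a x x<a)) p′) x<a) a<b) (ℕ.<-irrefl refl)
    ... | inj₂ a≤x = trans (sym (toℕ-punchIn-≥ a x a≤x)) p′
    y≡ : toℕ y ≡ toℕ a
    y≡ with ℕ.<-≤-connex (toℕ y) (toℕ b)
    ... | inj₁ y<b = trans (sym (toℕ-punchIn-< b y y<b)) q′
    ... | inj₂ b≤y = contradiction (ℕ.<-trans (subst (toℕ b <_) (trans (sym (toℕ-punchIn-≥ b y b≤y)) q′) (s≤s b≤y)) a<b) (ℕ.<-irrefl refl)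

  μ⇒Cross : ∀ u → Cross u (μ u) ⊎ Cross (μ u) u
  μ⇒Cross u with ℕ.<-cmp (toℕ (copy u)) (toℕ (target u))
  ... | tri< lt _ _ = inj₁ (target⇒Cross {u} {μ u} refl (target-μ u) lt)
  ... | tri≈ _ eq _ = contradiction (toℕ-injective (sym eq)) (target≢copy u)
  ... | tri> _ _ gt = inj₂ (target⇒Cross {μ u} {u} (target-μ u) refl gt)

-- Uids and labels: each DCell as one step over the previous one.

Adj : (k n : ℕ) → Fin (t k n) → Fin (t k n) → Set
Adj k n u v = DCell k n u v ≡ true

split-uid : ∀ T a x → x < T → split T (T * a + x) ≡ (a , x)
split-uid (suc m) a x x<T = cong₂ _,_ quot rem
  where
  quot : (suc m * a + x) / suc m ≡ a
  quot = trans (+-distrib-/-∣ˡ x (m∣m*n a)) (trans (cong₂ _+_ (trans (cong (_/ suc m) (*-comm (suc m) a)) (m*n/n≡m a (suc m))) (m<n⇒m/n≡0 x<T)) (ℕ.+-identityʳ a))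
  rem : (suc m * a + x) % suc m ≡ x
  rem = trans (cong (_% suc m) (trans (ℕ.+-comm (suc m * a) x) (cong (x +_) (*-comm (suc m) a))))
          (trans ([m+kn]%n≡m%n x a (suc m)) (m<n⇒m%n≡m x<T))

module UID (k n : ℕ) where
  private
    T = t k n
  open Pairs T
  open Equivalence

  size : suc T * T ≡ t (suc k) n
  size = trans (*-comm (suc T) T) (cong (T *_) (ℕ.+-comm 1 T))

  uid : V → Fin (t (suc k) n)
  uid (a , x) = cast size (combine a x)

  label : Fin (t (suc k) n) → V
  label w = remQuot T (cast (sym size) w)

  uid-label : ∀ w → uid (label w) ≡ w
  uid-label w = trans (cong (cast size) (combine-remQuot {suc T} T (cast (sym size) w))) (cast-involutive size (sym size) w)

  label-uid : ∀ u → label (uid u) ≡ u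
  label-uid (a , x) = trans (cong (remQuot T) (cast-involutive (sym size) size (combine a x))) (remQuot-combine a x)

  split-label : ∀ u → split T (toℕ (uid u)) ≡ (toℕ (proj₁ u) , toℕ (proj₂ u))
  split-label (a , x) = trans (cong (split T) (trans (toℕ-cast size _) (toℕ-combine a x))) (split-uid T (toℕ a) (toℕ x) (toℕ<n x))

  adj-uid : ∀ u v → DCell (suc k) n (uid u) (uid v) ≡
    ((toℕ (uid u) <ᵇ t (suc k) n) ∧ ((toℕ (uid v) <ᵇ t (suc k) n) ∧
     (((toℕ (proj₁ u) ≡ᵇ toℕ (proj₁ v)) ∧ adj k n (toℕ (proj₂ u)) (toℕ (proj₂ v)))
      ∨ (cross (toℕ (proj₁ u)) (toℕ (proj₂ u)) (toℕ (proj₁ v)) (toℕ (proj₂ v))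
      ∨ cross (toℕ (proj₁ v)) (toℕ (proj₂ v)) (toℕ (proj₁ u)) (toℕ (proj₂ u))))))
  adj-uid u v rewrite split-label u | split-label v = refl

  step⇒adj : ∀ {u v} → Step (Adj k n) u v → Adj (suc k) n (uid u) (uid v)
  step⇒adj {u} {v} s = trans (adj-uid u v) (to T-≡ (from T-∧ (<⇒<ᵇ (toℕ<n (uid u)) , from T-∧ (<⇒<ᵇ (toℕ<n (uid v)) , from T-∨ (edge s)))))
    where
    edge : ∀ {u v} → Step (Adj k n) u v →
      Bool.T ((toℕ (proj₁ u) ≡ᵇ toℕ (proj₁ v)) ∧ adj k n (toℕ (proj₂ u)) (toℕ (proj₂ v)))
      ⊎ Bool.T (cross (toℕ (proj₁ u)) (toℕ (proj₂ u)) (toℕ (proj₁ v)) (toℕ (proj₂ v))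
      ∨ cross (toℕ (proj₁ v)) (toℕ (proj₂ v)) (toℕ (proj₁ u)) (toℕ (proj₂ u)))
    edge (inner {a} e) = inj₁ (from T-∧ (≡⇒≡ᵇ (toℕ a) (toℕ a) refl , from T-≡ e))
    edge (across u) = inj₂ (from T-∨ (Sum.map (from T-≡) (from T-≡) (μ⇒Cross u)))

  adj⇒step : ∀ u v → Adj (suc k) n (uid u) (uid v) → Step (Adj k n) u v
  adj⇒step u v h with to (T-∧ {toℕ (uid u) <ᵇ t (suc k) n}) (from T-≡ (trans (sym (adj-uid u v)) h))
  ... | _ , h₁ with to (T-∧ {toℕ (uid v) <ᵇ t (suc k) n}) h₁
  ... | _ , h₂ with to (T-∨ {(toℕ (proj₁ u) ≡ᵇ toℕ (proj₁ v)) ∧ adj k n (toℕ (proj₂ u)) (toℕ (proj₂ v))}) h₂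
  ... | inj₁ h₃ with to (T-∧ {toℕ (proj₁ u) ≡ᵇ toℕ (proj₁ v)}) h₃
  ... | a≡b , e = same-copy (toℕ-injective (≡ᵇ⇒≡ _ _ a≡b)) (to T-≡ e)
    where
    same-copy : ∀ {u v} → copy u ≡ copy v → Adj k n (proj₂ u) (proj₂ v) → Step (Adj k n) u v
    same-copy refl e = inner e
  adj⇒step u v h | _ , h₁ | _ , h₂ | inj₂ h₃ with to (T-∨ {cross (toℕ (proj₁ u)) (toℕ (proj₂ u)) (toℕ (proj₁ v)) (toℕ (proj₂ v))}) h₃
  ... | inj₁ c = subst (Step (Adj k n) u) (Cross⇒μ {u = u} {v} (to T-≡ c)) (across u)
  ... | inj₂ c = subst (Step (Adj k n) u) (trans (cong μ (sym (Cross⇒μ {u = v} {u} (to T-≡ c)))) (μ-involutive v)) (across u)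

  step≅adj : Step (Adj k n) ≅ Adj (suc k) n
  step≅adj = record
    { to = uid ; from = label ; to-from = uid-label ; from-to = label-uid ; preserves = step⇒adj
    ; reflects = λ {w} {w′} e → adj⇒step (label w) (label w′) (subst₂ (Adj (suc k) n) (sym (uid-label w)) (sym (uid-label w′)) e) }

-- Degree, matching preclusion number and super matching from a 1-factorization.

lookup-injective : ∀ {A : Set} {xs : List A} → Unique xs → ∀ {i j} → lookup xs i ≡ lookup xs j → i ≡ j
lookup-injective (_ ∷ _) {zero} {zero} _ = refl
lookup-injective (x∉ ∷ _) {zero} {suc j} eq = contradiction eq (All.lookup x∉ (∈-lookup j))
lookup-injective (x∉ ∷ _) {suc i} {zero} eq = contradiction (sym eq) (All.lookup x∉ (∈-lookup i))
lookup-injective (_ ∷ u) {suc i} {suc j} eq = cong suc (lookup-injective u eq)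

module FiniteGraph {N d : ℕ} (A : Fin N → Fin N → Bool) (A-irr : ∀ {u} → A u u ≢ true)
                   (𝓕 : Factorization (λ u v → A u v ≡ true) d) where
  open Factorization 𝓕
  open Matching (Fin._≟_ {N}) using (Perfect)

  _~_ : Fin N → Fin N → Set
  u ~ v = A u v ≡ true

  -- Neighbours and colours inject into each other: a neighbour is reached by some colour, and
  -- distinct colours reach distinct neighbours.
  degree≡ : ∀ v → degree A v ≡ d
  degree≡ v = ℕ.≤-antisym (injective⇒≤ colour-injective) (injective⇒≤ index-injective)
    where
    nbrs = filterᵇ (A v) (allFin N)
    adjacent : ∀ i → v ~ lookup nbrs i
    adjacent i = Equivalence.to T-≡ (proj₂ (∈-filter⁻ (Bool.T? ∘ A v) {xs = allFin N} (∈-lookup i)))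
    colour : ∀ i → ∃ λ c → mate c v ≡ lookup nbrs i
    colour i = complete (adjacent i)
    colour-injective : ∀ {i j} → proj₁ (colour i) ≡ proj₁ (colour j) → i ≡ j
    colour-injective {i} {j} eq = lookup-injective (filter⁺ (Bool.T? ∘ A v) (allFin⁺ N))
      (trans (sym (proj₂ (colour i))) (trans (cong (λ c → mate c v) eq) (proj₂ (colour j))))
    mate∈ : ∀ c → mate c v ∈ nbrs
    mate∈ c = ∈-filter⁺ (Bool.T? ∘ A v) (∈-allFin _) (Equivalence.from T-≡ (ok c v))
    index-injective : ∀ {c c′} → Any.index (mate∈ c) ≡ Any.index (mate∈ c′) → c ≡ c′
    index-injective {c} {c′} eq = injective v
      (trans (lookup-index (mate∈ c)) (trans (cong (lookup nbrs) eq) (sym (lookup-index (mate∈ c′)))))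

  minDegree : Fin N → IsMinDegree A d
  minDegree v = (λ u → ℕ.≤-reflexive (sym (degree≡ u))) , v , degree≡ v

  toPerfectMatching : ∀ {ℓ} {f : Fin ℓ → Fin N × Fin N} F → (∀ {e} → e ∈ F → ∃ λ s → f s ≡ e) →
    Perfect (_~_ ∖ f) → PerfectMatching A (Delete A F)
  toPerfectMatching F F⊆f P = P.mate , P.involutive , λ u → proj₁ (P.ok u) ,
      (λ e∈F → proj₁ (proj₂ (P.ok u) _) (proj₂ (F⊆f e∈F))) ,
      (λ e∈F → proj₂ (proj₂ (P.ok u) _) (proj₂ (F⊆f e∈F)))
    where module P = Perfect P

  ∈⇒lookup : ∀ {F : List (Fin N × Fin N)} {e} → e ∈ F → ∃ λ s → lookup F s ≡ e
  ∈⇒lookup e∈F = Any.index e∈F , sym (lookup-index e∈F)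

  star : Fin N → List (Fin N × Fin N)
  star v = tabulate (λ c → v , mate c v)

  -- Every edge at v has a colour and is therefore listed, so v is left isolated. This is the upper
  -- bound d.
  star-preclusion : ∀ v → IsMatchingPreclusionSet A (star v)
  star-preclusion v = (All.tabulate⁺ (λ c → ok c v) , AllPairs.tabulate⁺ distinct) , no-perfect
    where
    distinct : ∀ {c c′} → c ≢ c′ → ¬ SameEdge A (v , mate c v) (v , mate c′ v)
    distinct c≢c′ (inj₁ (_ , eq)) = c≢c′ (injective v eq)
    distinct {c} {c′} c≢c′ (inj₂ (eq , _)) = A-irr (subst (v ~_) (sym eq) (ok c′ v))
    no-perfect : ¬ PerfectMatching A (Delete A (star v))
    no-perfect (m , _ , m-ok) with m-ok v
    ... | v~mv , ∉F , _ with complete v~mv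
    ... | c , eq = ∉F (subst (λ u → (v , u) ∈ star v) eq (∈-tabulate⁺ {f = λ c → v , mate c v} c))

  mpNumber : Fin N → IsMPNumber A d
  mpNumber v = (star v , star-preclusion v , length-tabulate _) , lower
    where
    lower : ∀ F → IsMatchingPreclusionSet A F → d ≤ length F
    lower F (_ , no-perfect) = decidable-stable (d ℕ.≤? length F) λ d≰ → no-perfect
      (toPerfectMatching F ∈⇒lookup (Colouring.few⇒perfect Fin._≟_ 𝓕 (lookup F) (ℕ.≰⇒> d≰)))

  superMatched : Fin N → (∀ (f : Fin d → Fin N × Fin N) → Perfect (_~_ ∖ f) ⊎ Star _~_ f) → SuperMatched A
  -- Matching on `refl` identifies d with `length F`, so that the dichotomy applies to the family
  -- `lookup F`.
  superMatched v perfect-or-star = d , minDegree v , mpNumber v , λ { F (_ , no-perfect) refl → trivial F no-perfect perfect-or-star }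
    where
    trivial : ∀ F → ¬ PerfectMatching A (Delete A F) →
      (∀ (f : Fin (length F) → Fin N × Fin N) → Perfect (_~_ ∖ f) ⊎ Star _~_ f) → IsTrivial A F
    trivial F no-perfect dichotomy with dichotomy (lookup F)
    ... | inj₁ P = contradiction (toPerfectMatching F ∈⇒lookup P) no-perfect
    ... | inj₂ (z , at-z , all) = z , incident , λ u z~u → covered u z~u
      where
      incident : ∀ e → e ∈ F → proj₁ e ≡ z ⊎ proj₂ e ≡ z
      incident e e∈F = subst (λ e → proj₁ e ≡ z ⊎ proj₂ e ≡ z) (proj₂ (∈⇒lookup e∈F)) (at-z _)
      covered : ∀ u → z ~ u → (z , u) ∈ F ⊎ (u , z) ∈ F
      covered u z~u with all z~u
      ... | s , inj₁ eq = inj₁ (subst (_∈ F) eq (∈-lookup s))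
      ... | s , inj₂ eq = inj₂ (subst (_∈ F) eq (∈-lookup s))

-- 1-factorizations of complete graphs of even order.

complete-perfect-colouring : ∀ {M} (m : Fin M → Fin (suc M) → Fin (suc M)) →
  (∀ c u → m c (m c u) ≡ u) → (∀ c u → u ≢ m c u) → (∀ {c c′} u → m c u ≡ m c′ u → c ≡ c′) →
  Factorization (_≢_ {A = Fin (suc M)}) M
complete-perfect-colouring {M} m inv fix inj = record
  { mate = m ; involutive = inv ; ok = fix ; complete = complete ; injective = inj }
  where
  complete : ∀ {u v} → u ≢ v → ∃ λ c → m c u ≡ v
  -- The M colours give u distinct mates among the M other vertices, so every one of these occurs.
  complete {u} {v} u≢v with injective⇒surjective (λ c → punchOut (fix c u))
    (λ {c} {c′} eq → inj u (punchOut-injective (fix c u) (fix c′ u) eq)) (punchOut u≢v)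
  ... | c , eq = c , punchOut-injective (fix c u) u≢v eq

-- Round robin: vertex zero plays the odd one out, and the others are paired by i + j ≡ 2c modulo M.
module RoundRobin (h : ℕ) where

  M : ℕ
  M = suc (h + h)

  cancel : ∀ i {j j′} → i ≤ M → (i + j) % M ≡ (i + j′) % M → j % M ≡ j′ % M
  cancel i {j} {j′} i≤M eq = trans (sym (shift j)) (trans (cong (λ r → ((M ∸ i) % M + r) % M) eq) (shift j′))
    where
    shift : ∀ j → ((M ∸ i) % M + (i + j) % M) % M ≡ j % M
    shift j = begin
      ((M ∸ i) % M + (i + j) % M) % M ≡⟨ %-distribˡ-+ (M ∸ i) (i + j) M ⟨
      (M ∸ i + (i + j)) % M           ≡⟨ cong (_% M) (ℕ.+-assoc (M ∸ i) i j) ⟨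
      (M ∸ i + i + j) % M             ≡⟨ cong (λ k → (k + j) % M) (ℕ.m∸n+n≡m i≤M) ⟩
      (M + j) % M                     ≡⟨ cong (_% M) (ℕ.+-comm M j) ⟩
      (j + M) % M                     ≡⟨ [m+n]%n≡m%n j M ⟩
      j % M                           ∎
      where open ≡-Reasoning

  -- M is odd, and h + 1 is the inverse of 2 modulo M.
  halve : ∀ i j → (i + i) % M ≡ (j + j) % M → i % M ≡ j % M
  halve i j eq = trans (sym (twice i)) (trans (cong (λ r → (r * (suc h % M)) % M) eq) (twice j))
    where
    expand : ∀ i h → (i + i) * suc h ≡ i + i * suc (h + h)
    expand = solve-∀
    twice : ∀ i → (((i + i) % M) * (suc h % M)) % M ≡ i % M
    twice i = begin
      (((i + i) % M) * (suc h % M)) % M ≡⟨ %-distribˡ-* (i + i) (suc h) M ⟨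
      ((i + i) * suc h) % M             ≡⟨ cong (_% M) (expand i h) ⟩
      (i + i * M) % M                   ≡⟨ [m+kn]%n≡m%n i i M ⟩
      i % M                             ∎
      where open ≡-Reasoning

  ≡-mod : ∀ {i j : Fin M} → toℕ i % M ≡ toℕ j % M → i ≡ j
  ≡-mod {i} {j} eq = toℕ-injective (trans (sym (m<n⇒m%n≡m (toℕ<n i))) (trans eq (m<n⇒m%n≡m (toℕ<n j))))

  Reflected : Fin M → Fin M → Fin M → Set
  Reflected c i j = (toℕ i + toℕ j) % M ≡ (toℕ c + toℕ c) % M

  -- This is 2c - i modulo M, with M - i in place of - i to stay within the natural numbers.
  reflect : Fin M → Fin M → Fin M
  reflect c i = fromℕ< (m%n<n (toℕ c + toℕ c + (M ∸ toℕ i)) M)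

  i≤M : ∀ (i : Fin M) → toℕ i ≤ M
  i≤M i = ℕ.<⇒≤ (toℕ<n i)

  reflected : ∀ c i → Reflected c i (reflect c i)
  reflected c i = begin
    (toℕ i + toℕ (reflect c i)) % M ≡⟨ cong (λ r → (toℕ i + r) % M) (toℕ-fromℕ< _) ⟩
    (toℕ i + D % M) % M             ≡⟨ %-distribˡ-+ (toℕ i) (D % M) M ⟩
    (toℕ i % M + D % M % M) % M     ≡⟨ cong (λ r → (toℕ i % M + r) % M) (m%n%n≡m%n D M) ⟩
    (toℕ i % M + D % M) % M         ≡⟨ %-distribˡ-+ (toℕ i) D M ⟨
    (toℕ i + D) % M                 ≡⟨ cong (_% M) (trans (ℕ.+-comm (toℕ i) D) (ℕ.+-assoc C (M ∸ toℕ i) (toℕ i))) ⟩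
    (C + (M ∸ toℕ i + toℕ i)) % M   ≡⟨ cong (λ k → (C + k) % M) (ℕ.m∸n+n≡m (i≤M i)) ⟩
    (C + M) % M                     ≡⟨ [m+n]%n≡m%n C M ⟩
    C % M                           ∎
    where
    open ≡-Reasoning
    C = toℕ c + toℕ c
    D = C + (M ∸ toℕ i)

  reflected-unique : ∀ {c} i {j j′} → Reflected c i j → Reflected c i j′ → j ≡ j′
  reflected-unique i r r′ = ≡-mod (cancel (toℕ i) (i≤M i) (trans r (sym r′)))

  reflected-sym : ∀ {c i j} → Reflected c i j → Reflected c j i
  reflected-sym {c} {i} {j} r = trans (cong (_% M) (ℕ.+-comm (toℕ j) (toℕ i))) r

  reflected-diagonal : ∀ {c i} → Reflected c i i → i ≡ c
  reflected-diagonal {c} {i} r = ≡-mod (halve (toℕ i) (toℕ c) r)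

  pair : Fin M → Fin (suc M) → Fin (suc M)
  pair c zero = suc c
  pair c (suc i) with i Fin.≟ c
  ... | yes _ = zero
  ... | no _ = suc (reflect c i)

  pair-centre : ∀ c → pair c (suc c) ≡ zero
  pair-centre c with c Fin.≟ c
  ... | yes _ = refl
  ... | no c≢c = contradiction refl c≢c

  pair-off : ∀ {c i} → i ≢ c → pair c (suc i) ≡ suc (reflect c i)
  pair-off {c} {i} i≢c with i Fin.≟ c
  ... | yes i≡c = contradiction i≡c i≢c
  ... | no _ = refl

  pair-involutive : ∀ c u → pair c (pair c u) ≡ u
  pair-involutive c zero = pair-centre c
  pair-involutive c (suc i) with i Fin.≟ c
  ... | yes refl = refl
  ... | no i≢c = trans (pair-off r≢c) (cong suc (reflected-unique {c} (reflect c i)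
          (reflected c (reflect c i)) (reflected-sym {c} {i} (reflected c i))))
    where
    r≢c : reflect c i ≢ c
    r≢c eq = i≢c (reflected-unique {c} c (reflected-sym {c} {i} (subst (Reflected c i) eq (reflected c i))) refl)

  pair-no-fix : ∀ c u → u ≢ pair c u
  pair-no-fix c zero ()
  pair-no-fix c (suc i) eq with i Fin.≟ c
  pair-no-fix c (suc i) () | yes _
  ... | no i≢c = i≢c (reflected-diagonal (subst (Reflected c i) (sym (suc-injective eq)) (reflected c i)))

  pair-injective : ∀ {c c′} u → pair c u ≡ pair c′ u → c ≡ c′
  pair-injective zero eq = suc-injective eq
  pair-injective {c} {c′} (suc i) eq with i Fin.≟ c | i Fin.≟ c′
  ... | yes i≡c | yes i≡c′ = trans (sym i≡c) i≡c′
  ... | no _ | no _ = ≡-mod (halve (toℕ c) (toℕ c′) (trans (sym (reflected c i))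
          (trans (cong (λ j → (toℕ i + toℕ j) % M) (suc-injective eq)) (reflected c′ i))))

  complete-factorization : Factorization (_≢_ {A = Fin (suc M)}) M
  complete-factorization = complete-perfect-colouring pair pair-involutive pair-no-fix pair-injective

≢-irr : ∀ {A : Set} {x : A} → ¬ (x ≢ x)
≢-irr x≢x = x≢x refl

-- One rotation of any colour class suffices, since distinct vertices are always adjacent.
complete-bicritical : ∀ {N d} → Factorization (_≢_ {A = Fin N}) (suc d) → Matching.Bicritical Fin._≟_ (_≢_ {A = Fin N})
complete-bicritical 𝓕 x w x≢w = proj₁ (retarget ≢-sym ≢-irr (perfect-near P x) (ok zero x) x≢w mates-differ)
  where
  open Factorization 𝓕
  open Matching Fin._≟_
  P = Colouring.class Fin._≟_ 𝓕 zero
  mates-differ : w ≢ mate zero x → mate zero x ≢ mate zero w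
  mates-differ _ eq = x≢w (trans (sym (involutive zero x)) (trans (cong (mate zero) eq) (involutive zero w)))

-- D_1 over a complete graph of odd order.

-- The first level over a complete graph K_M: vertices are ordered pairs (copy , target) of distinct
-- elements of Fin (suc M), and a colour class of K_(suc M) acts on the target, except that
-- a pair whose target is sent to its copy is reversed.
module FirstLevel {M : ℕ} (𝓚 : Factorization (_≢_ {A = Fin (suc M)}) M) where
  open Pairs M
  private
    module K = Factorization 𝓚
  open Matching _≟_

  _~_ : V → V → Set
  _~_ = Step _≢_

  same-copy : ∀ {u v} → copy u ≡ copy v → u ≢ v → u ~ v
  same-copy {a , x} {_ , y} refl u≢v = inner (u≢v ∘ cong (a ,_))

  mate : Fin M → V → V
  mate c u with K.mate c (target u) Fin.≟ copy u
  ... | yes _ = μ u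
  ... | no ≢copy = link (≢copy ∘ sym)

  mate-cross : ∀ {c u} → K.mate c (target u) ≡ copy u → mate c u ≡ μ u
  mate-cross {c} {u} eq with K.mate c (target u) Fin.≟ copy u
  ... | yes _ = refl
  ... | no ≢copy = contradiction eq ≢copy

  mate-inner : ∀ {c u} → K.mate c (target u) ≢ copy u →
    copy (mate c u) ≡ copy u × target (mate c u) ≡ K.mate c (target u)
  mate-inner {c} {u} ≢copy with K.mate c (target u) Fin.≟ copy u
  ... | yes eq = contradiction eq ≢copy
  ... | no ≢copy′ = refl , target-link (≢copy′ ∘ sym)

  involutive : ∀ c u → mate c (mate c u) ≡ u
  involutive c u with K.mate c (target u) Fin.≟ copy u
  ... | yes eq = trans (mate-cross (trans (cong (K.mate c) (target-μ u)) (trans (cong (K.mate c) (sym eq)) (K.involutive c _))))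
                       (μ-involutive u)
  ... | no ≢copy = vertex-ext (proj₁ again) (trans (proj₂ again) back)
    where
    v = link (≢copy ∘ sym)
    back : K.mate c (target v) ≡ target u
    back = trans (cong (K.mate c) (target-link (≢copy ∘ sym))) (K.involutive c _)
    again = mate-inner {c} {v} (λ eq → target≢copy u (trans (sym back) eq))

  ok : ∀ c u → u ~ mate c u
  ok c u with K.mate c (target u) Fin.≟ copy u
  ... | yes _ = across u
  ... | no ≢copy = same-copy refl λ eq → K.ok c (target u) (trans (cong target eq) (target-link (≢copy ∘ sym)))

  injective : ∀ {c c′} u → mate c u ≡ mate c′ u → c ≡ c′
  injective {c} {c′} u eq with K.mate c (target u) Fin.≟ copy u | K.mate c′ (target u) Fin.≟ copy u
  ... | yes p | yes p′ = K.injective _ (trans p (sym p′))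
  ... | yes _ | no _ = contradiction (cong copy eq) (target≢copy u)
  ... | no _ | yes _ = contradiction (sym (cong copy eq)) (target≢copy u)
  ... | no p | no p′ = K.injective _ (trans (sym (target-link (p ∘ sym))) (trans (cong target eq) (target-link (p′ ∘ sym))))

  -- An inner edge has the colour of its two targets in K_(M+1), and a cross edge that of the two
  -- copies it joins.
  complete : ∀ {u v} → u ~ v → ∃ λ c → mate c u ≡ v
  complete (inner {a} {x} {y} x≢y) with K.complete (x≢y ∘ punchIn-injective a x y)
  ... | c , eq = c , vertex-ext (proj₁ i) (trans (proj₂ i) eq)
    where i = mate-inner {c} {a , x} (λ eq′ → target≢copy (a , y) (trans (sym eq) eq′))
  complete (across u) with K.complete (target≢copy u)
  ... | c , eq = c , mate-cross eq

  first-factorization : Factorization _~_ M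
  first-factorization = record { mate = mate ; involutive = involutive ; ok = ok ; complete = complete ; injective = injective }

  ~-sym : Symmetric _~_
  ~-sym = step-sym ≢-sym ≢-irr

  ~-irr : ∀ {u} → ¬ u ~ u
  ~-irr = step-irr ≢-sym ≢-irr

  mate-≢ : ∀ {c u v} → u ≢ v → mate c u ≢ mate c v
  mate-≢ {c} u≢v eq = u≢v (trans (sym (involutive c _)) (trans (cong (mate c) eq) (involutive c _)))

  near : ∀ c u → Near _~_ u (mate c u)
  near c = perfect-near (Colouring.class _≟_ first-factorization c)

  ≢-self : ∀ c u → u ≢ mate c u
  ≢-self c u eq = ~-irr (subst (u ~_) (sym eq) (ok c u))

  bicritical-same-copy : 3 ≤ M → ∀ {x w} → copy x ≡ copy w → x ≢ w → Near _~_ x w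
  bicritical-same-copy 3≤M {x} {w} x≈w x≢w
    with K.complete (target≢copy x) | K.complete (target≢copy w)
  -- The colours c₁ and c₂ are those that reverse x and w. In a third colour both mates stay in the
  -- common copy, a complete graph, so one rotation is enough.
  ... | c₁ , eq₁ | c₂ , eq₂ with fresh (c₁ ∷ c₂ ∷ []) 3≤M
  ... | c , c≢c₁ ∷ c≢c₂ ∷ [] = proj₁ (retarget ~-sym ~-irr (near c x) (≢-self c x) x≢w λ _ →
          same-copy (trans (proj₁ (mate-inner λ eq → c≢c₁ (K.injective _ (trans eq (sym eq₁)))))
                    (trans x≈w (sym (proj₁ (mate-inner λ eq → c≢c₂ (K.injective _ (trans eq (sym eq₂))))))))
                    (mate-≢ x≢w))

  -- In the colour pairing p with q, the cross edge u-v is the only edge of the class leaving these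
  -- two copies. Taking u-v as the deficient pair, v is moved to w inside copy q and then u to x
  -- inside copy p.
  bicritical-distinct-copies : ∀ {x w} → copy x ≢ copy w → Near _~_ x w
  bicritical-distinct-copies {x} {w} p≢q with K.complete (p≢q ∘ sym)
  ... | c , q↦p = near-sym (proj₁ (retarget ~-sym ~-irr (near-sym (proj₁ near₂)) (u≢w ∘ sym) (x≢w ∘ sym) u~))
    where
    x≢w : x ≢ w
    x≢w = p≢q ∘ cong copy
    u : V
    u = link p≢q
    v : V
    v = link (p≢q ∘ sym)
    u≢v : u ≢ v
    u≢v = p≢q ∘ cong copy
    u≢w : u ≢ w
    u≢w = p≢q ∘ cong copy
    u↦v : mate c u ≡ v
    u↦v = trans (mate-cross (trans (cong (K.mate c) (target-link p≢q)) q↦p)) (μ-link p≢q (p≢q ∘ sym))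
    v↦u : mate c v ≡ u
    v↦u = trans (cong (mate c) (sym u↦v)) (involutive c u)
    -- If the colour pairs a with b, only the vertex of copy a with target b is reversed.
    stays : ∀ {z a b} (a≢b : a ≢ b) → copy z ≡ a → K.mate c b ≡ a → z ≢ link a≢b → copy (mate c z) ≡ copy z
    stays {z} a≢b refl eq z≢ = proj₁ (mate-inner {c} {z} λ eq′ → z≢ (vertex-ext refl
      (trans (trans (sym (K.involutive c _)) (trans (cong (K.mate c) (trans eq′ (sym eq))) (K.involutive c _)))
             (sym (target-link a≢b)))))
    p↦q : K.mate c (copy x) ≡ copy w
    p↦q = trans (cong (K.mate c) (sym q↦p)) (K.involutive c _)
    w-stays : w ≢ v → copy (mate c w) ≡ copy w
    w-stays = stays (p≢q ∘ sym) refl p↦q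
    near₂ = retarget ~-sym ~-irr near₁ u≢v u≢w λ w≢v →
        same-copy (sym (w-stays w≢v)) λ eq → u≢w (trans (sym v↦u) (trans (cong (mate c) eq) (involutive c w)))
      where
      near₁ : Near _~_ u v
      near₁ = record { mate = mate c ; involutive = involutive c ; at = u↦v ; ok = λ z _ _ → ok c z }
    u~ : x ≢ u → u ~ Near.mate (near-sym (proj₁ near₂)) x
    u~ x≢u = subst (u ~_) (sym kept) (same-copy (sym (stays p≢q refl q↦p x≢u)) λ eq →
        p≢q (cong copy (trans (sym (involutive c x)) (trans (cong (mate c) (sym eq)) u↦v))))
      where
      x≢mate-w : x ≢ mate c w
      x≢mate-w eq with w ≟ v
      ... | yes refl = x≢u (trans eq v↦u)
      ... | no w≢v = p≢q (trans (cong copy eq) (w-stays w≢v))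
      -- The first rotation changed mates only at u, v, w and the mate of w, so the mate of x is
      -- still the one in colour c.
      kept : Near.mate (proj₁ near₂) x ≡ mate c x
      kept = proj₂ near₂ x x≢u (p≢q ∘ cong copy) x≢mate-w x≢w

  first-bicritical : 3 ≤ M → Bicritical _~_
  first-bicritical 3≤M x w x≢w with copy x Fin.≟ copy w
  ... | yes x≈w = bicritical-same-copy 3≤M x≈w x≢w
  ... | no p≢q = bicritical-distinct-copies p≢q

-- D_0 as a complete graph; symmetry and irreflexivity on all levels.

≢≅adj : ∀ {n} → (_≢_ {A = Fin n}) ≅ Adj 0 n
≢≅adj {n} = record
  { to = id ; from = id ; to-from = λ _ → refl ; from-to = λ _ → refl ; preserves = preserves ; reflects = λ {u} {v} → reflects {u} {v} }
  where
  open Equivalence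
  preserves : {u v : Fin n} → u ≢ v → Adj 0 n u v
  preserves {u} {v} u≢v = to T-≡ (from T-∧ (<⇒<ᵇ (toℕ<n u) , from T-∧ (<⇒<ᵇ (toℕ<n v) ,
    from T-≡ (cong Bool.not (¬-not (u≢v ∘ toℕ-injective ∘ ≡ᵇ⇒≡ (toℕ u) (toℕ v) ∘ from T-≡))))))
  reflects : {u v : Fin n} → Adj 0 n u v → u ≢ v
  reflects {u} e refl with to (T-∧ {toℕ u ℕ.<ᵇ n}) (from T-≡ e)
  ... | _ , e′ with to (T-∧ {toℕ u ℕ.<ᵇ n}) e′
  ... | _ , e″ with trans (sym (to T-≡ (≡⇒≡ᵇ (toℕ u) (toℕ u) refl))) (to T-not-≡ e″)
  ... | ()

step-map : ∀ {T} {E E′ : Fin T → Fin T → Set} → (∀ {x y} → E x y → E′ x y) → ∀ {u v} → Pairs.Step T E u v → Pairs.Step T E′ u v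
step-map h (Pairs.inner e) = Pairs.inner (h e)
step-map h (Pairs.across u) = Pairs.across u

step-≅ : ∀ {T} {E E′ : Fin T → Fin T → Set} → (∀ {x y} → E x y → E′ x y) → (∀ {x y} → E′ x y → E x y) →
  Pairs.Step T E ≅ Pairs.Step T E′
step-≅ h h′ = record { to = id ; from = id ; to-from = λ _ → refl ; from-to = λ _ → refl ; preserves = step-map h ; reflects = step-map h′ }

abstract
  adj-sym : ∀ k n {u v} → Adj k n u v → Adj k n v u
  adj-irr : ∀ k n {u} → ¬ Adj k n u u

  adj-sym zero n {u} {v} e = preserves (≢-sym (reflects {u} {v} e))
    where open _≅_ (≢≅adj {n})
  adj-sym (suc k) n {u} {v} = Transport.sym-transport {_≟ᵛ_ = Pairs._≟_ (t k n)} {_≟ʷ_ = Fin._≟_} (UID.step≅adj k n)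
    (Pairs.step-sym (t k n) {E = Adj k n} (adj-sym k n) (adj-irr k n)) {u} {v}

  adj-irr zero n {u} e = _≅_.reflects (≢≅adj {n}) {u} {u} e refl
  adj-irr (suc k) n {u} = Transport.irr-transport {_≟ᵛ_ = Pairs._≟_ (t k n)} {_≟ʷ_ = Fin._≟_} (UID.step≅adj k n)
    (Pairs.step-irr (t k n) {E = Adj k n} (adj-sym k n) (adj-irr k n)) {u}

-- The case n = 2, by search.

-- D_{1,2} is a 6-cycle, which is not bicritical, so what the higher levels need over it is found
-- by search: a walk moves the end w of the deficient pair x–w by successive rotations.
module Hexagon where

  hexagon : Factorization (Adj 1 2) 2
  hexagon = record
    { mate = mate
    ; involutive = toWitness {a? = all? λ c → all? λ u → mate c (mate c u) Fin.≟ u} _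
    ; ok = toWitness {a? = all? λ c → all? λ u → DCell 1 2 u (mate c u) Bool.≟ true} _
    ; complete = λ {u} {v} → toWitness {a? = all? λ u → all? λ v →
        (DCell 1 2 u v Bool.≟ true) →-dec any? λ c → mate c u Fin.≟ v} _ u v
    ; injective = λ {c} {c′} u → toWitness {a? = all? λ c → all? λ c′ → all? λ u →
        (mate c u Fin.≟ mate c′ u) →-dec (c Fin.≟ c′)} _ c c′ u }
    where
    mate : Fin 2 → Fin 6 → Fin 6
    mate c u = Vec.lookup (Vec.lookup
      -- The first row holds the cross edges 0-2, 1-4, 3-5, the second the edges 0-1, 2-3, 4-5
      -- inside the copies of K_2.
      (((# 2) ∷ (# 4) ∷ (# 0) ∷ (# 5) ∷ (# 1) ∷ (# 3) ∷ []) ∷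
       ((# 1) ∷ (# 0) ∷ (# 3) ∷ (# 2) ∷ (# 5) ∷ (# 4) ∷ []) ∷ []) c) u

  open Pairs 6
  open Matching _≟_
  open Faults {E = Adj 1 2} (λ {u} {v} → adj-sym 1 2 {u} {v}) (λ {u} → adj-irr 1 2 {u}) hexagon
    using (𝓖; Spared; inner; colour; across; OffCrossEdge; Bypass; near-spared; spared-sym; spared⇒step)
  private
    module G = Factorization 𝓖
    module F = Factorization hexagon

  _~_ : V → V → Set
  _~_ = Step (Adj 1 2)

  ~-sym : Symmetric _~_
  ~-sym = step-sym {E = Adj 1 2} (λ {u} {v} → adj-sym 1 2 {u} {v}) (λ {u} → adj-irr 1 2 {u})

  ~-irr : ∀ {u} → ¬ u ~ u
  ~-irr = step-irr {E = Adj 1 2} (λ {u} {v} → adj-sym 1 2 {u} {v}) (λ {u} → adj-irr 1 2 {u})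

  -- Searches may fail, hence `Maybe`; `from-just` type checks only if evaluation finds a success in
  -- every case.
  everywhere : ∀ {n} {P : Fin n → Set} → (∀ i → Maybe (P i)) → Maybe (∀ i → P i)
  everywhere {zero} f = just λ ()
  everywhere {suc n} f with f zero | everywhere (f ∘ suc)
  ... | just p | just ps = just λ { zero → p ; (suc i) → ps i }
  ... | _ | _ = nothing

  everywhere² : ∀ {P : V → Set} → (∀ u → Maybe (P u)) → Maybe (∀ u → P u)
  everywhere² f with everywhere (λ a → everywhere λ x → f (a , x))
  ... | just p = just λ (a , x) → p a x
  ... | nothing = nothing

  module _ (x : V) where

    walks : ℕ → ∃ (Near _~_ x) → List (∃ (Near _~_ x))
    extend : ℕ → ∃ (Near _~_ x) → Fin 3 → List (∃ (Near _~_ x))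
    walks zero N = N ∷ []
    -- The walks start from the class of cross edges, so each rotation takes an edge of one of the
    -- two inner colours.
    walks (suc n) N = N ∷ extend n N (# 1) ++ extend n N (# 2)
    extend n (w , N) c with x ≟ w | G.mate c w ≟ x
    ... | no x≢w | no z≢x = walks n (_ , proj₁ (rotate ~-sym ~-irr N x≢w (G.ok c w) z≢x))
    ... | _ | _ = []

    reach : List (∃ (Near _~_ x)) → ∀ y → Maybe (x ≢ y → Near _~_ x y)
    reach [] y with x ≟ y
    ... | yes x≡y = just λ x≢y → contradiction x≡y x≢y
    ... | no _ = nothing
    reach ((w , N) ∷ Ns) y with w ≟ y
    ... | yes refl = just λ _ → N
    ... | no _ = reach Ns y

    reach-all : List (∃ (Near _~_ x)) → Maybe (∀ y → x ≢ y → Near _~_ x y)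
    reach-all Ns = everywhere² (reach Ns)

  module _ (i : Fin 7) (c : Fin 2) (x : Fin 6) where
    private
      -- The search admits all cross edges. Afterwards `pick` selects a matching that misses the
      -- given e, so one list serves every e.
      R : V → V → Set
      R = Spared i c x (λ _ → ⊤)
      R-sym : Symmetric R
      R-sym = spared-sym (λ _ → tt)
      v : V
      v = i , x
      y : Fin 6
      y = F.mate c x

    -- The walk starts at the far end of the dropped edge of colour c. When it reaches `μ v`, the
    -- cross edge at v closes it to a perfect matching.
    closed-walks : ℕ → ∃ (Near R v) → List (Perfect R)
    turn : ℕ → ∀ {w z} → Near R v w → R w z → List (Perfect R)
    finish : ∃ (Near R v) → List (Perfect R)
    closed-walks zero N = finish N
    closed-walks (suc n) (w , N) = finish (w , N) ++ turn-inner ++ turn n N (across tt)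
      where
      turn-inner : List (Perfect R)
      turn-inner with copy w Fin.≟ i
      ... | yes _ = []
      -- The initial matching has colour c, so an inner step takes the other colour; in copy i such
      -- an edge might be faulty.
      ... | no a≢i = turn n N (inner {y = proj₂ w} {z = F.mate (opposite c) (proj₂ w)} a≢i (F.ok (opposite c) (proj₂ w)))
    turn n {w} {z} N wz with v ≟ w | z ≟ v
    ... | no v≢w | no z≢v = closed-walks n (_ , proj₁ (rotate R-sym (~-irr ∘ spared⇒step) N v≢w wz z≢v))
    ... | _ | _ = []
    finish (w , N) with w ≟ μ v
    ... | yes refl = close R-sym N (across tt) ∷ []
    ... | no _ = []

    -- A cross edge of the matching at either end of e would be e, which the matching does not use.
    avoid : ∀ e (P : Perfect R) → Perfect.mate P e ≢ μ e → Perfect (Spared i c x (OffCrossEdge e))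
    avoid e P e↛ = record { mate = mate ; involutive = involutive ; ok = λ u → restrict (ok u) refl }
      where
      open Perfect P
      restrict : ∀ {u w} → R u w → w ≡ mate u → Spared i c x (OffCrossEdge e) u w
      restrict (inner a≢i yz) _ = inner a≢i yz
      restrict (colour u≢x u≢y) _ = colour u≢x u≢y
      restrict (across {u} _) eq = across (u≢e , u≢μe)
        where
        u≢e : u ≢ e
        u≢e refl = e↛ (sym eq)
        u≢μe : u ≢ μ e
        u≢μe refl = e↛ (trans (cong mate (trans (sym (μ-involutive e)) eq)) (involutive (μ e)))

    Bypassed : V → Set
    Bypassed e = v ≢ e → v ≢ μ e → (i , y) ≢ e → (i , y) ≢ μ e → Perfect (Spared i c x (OffCrossEdge e))

    pick : List (Perfect R) → ∀ e → Maybe (Bypassed e)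
    pick [] e = nothing
    pick (P ∷ Ps) e with Perfect.mate P e ≟ μ e
    ... | no e↛ = just λ _ _ _ _ → avoid e P e↛
    ... | yes _ = pick Ps e

    bypassed? : List (Perfect R) → ∀ e → Maybe (Bypassed e)
    bypassed? Ps e with v ≟ e | v ≟ μ e | (i , y) ≟ e | (i , y) ≟ μ e
    ... | yes p | _ | _ | _ = just λ q → contradiction p q
    ... | _ | yes p | _ | _ = just λ _ q → contradiction p q
    ... | _ | _ | yes p | _ = just λ _ _ q → contradiction p q
    ... | _ | _ | _ | yes p = just λ _ _ _ q → contradiction p q
    ... | no _ | no _ | no _ | no _ = pick Ps e

    bypassed-all : List (Perfect R) → Maybe (∀ e → Bypassed e)
    bypassed-all Ps = everywhere² (bypassed? Ps)

  -- Walks of length at most 11 settle every case, most of them at length 7.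
  bypass? : Maybe Bypass
  bypass? = everywhere λ i → everywhere λ c → everywhere λ x →
    bypassed-all i c x (concatMap (λ n → closed-walks i c x n (_ , near-spared)) (7 ∷ 9 ∷ 11 ∷ []))

  bicritical? : Maybe (Bicritical _~_)
  -- At most eight rotations lead from any x to every possible partner.
  bicritical? = everywhere² λ x → reach-all x (walks x 8 (_ , perfect-near (Colouring.class _≟_ 𝓖 zero) x))

  hexagon-step-bicritical : Bicritical _~_
  hexagon-step-bicritical = from-just bicritical?

  hexagon-bypass : Bypass
  hexagon-bypass = from-just bypass?

-- Induction on the level.

module Level (k n : ℕ) where
  private
    T = t k n
    E-sym : Symmetric (Adj k n)
    E-sym {u} {v} = adj-sym k n {u} {v}
    E-irr : ∀ {u} → ¬ Adj k n u u
    E-irr {u} = adj-irr k n {u}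
    module Up = Transport {_≟ᵛ_ = Pairs._≟_ T} {_≟ʷ_ = Fin._≟_} (UID.step≅adj k n)

  next-factorization : ∀ {d} → Factorization (Adj k n) d → Factorization (Adj (suc k) n) (suc d)
  next-factorization 𝓕 = Up.factorization-transport (Pairs.step-factorization T {E = Adj k n} E-sym E-irr 𝓕)

  next-bicritical : ∀ {d} → Factorization (Adj k n) d → Fin d → 4 ≤ T →
    Matching.Bicritical Fin._≟_ (Adj k n) → Matching.Bicritical Fin._≟_ (Adj (suc k) n)
  next-bicritical 𝓕 c 4≤T bic = Up.bicritical-transport (Pairs.step-bicritical T {E = Adj k n} E-sym E-irr 𝓕 c 4≤T bic)

  Bypass : ∀ {d} → Factorization (Adj k n) d → Set
  Bypass = Faults.Bypass {E = Adj k n} E-sym E-irr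

  next-bypass : ∀ {d} (𝓕 : Factorization (Adj k n) d) → 5 ≤ T → Matching.Bicritical Fin._≟_ (Adj k n) → Bypass 𝓕
  next-bypass = Faults.bicritical⇒bypass {E = Adj k n} E-sym E-irr

  next-perfect-or-star : ∀ {d} (𝓕 : Factorization (Adj k n) d) → Bypass 𝓕 →
    ∀ (f : Fin (suc d) → Fin (t (suc k) n) × Fin (t (suc k) n)) →
    Matching.Perfect Fin._≟_ (Adj (suc k) n ∖ f) ⊎ Star (Adj (suc k) n) f
  next-perfect-or-star 𝓕 bypass f = Sum.map (Up.perfect-transport f) (Up.star-transport f)
    (Faults.perfect-or-star {E = Adj k n} E-sym E-irr 𝓕 bypass (Up.pullback f))

t-grows : ∀ k n → t k n ≤ t (suc k) n
t-grows k n = ℕ.m≤m*n (t k n) (t k n + 1) {{ℕ.>-nonZero (ℕ.m≤n+m 1 (t k n))}}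

t-≥-first : ∀ j n → t 1 n ≤ t (suc j) n
t-≥-first zero n = ℕ.≤-refl
t-≥-first (suc j) n = ℕ.≤-trans (t-≥-first j n) (t-grows (suc j) n)

t₁-≥6 : ∀ {n} → 2 ≤ n → 6 ≤ t 1 n
t₁-≥6 2≤n = ℕ.*-mono-≤ 2≤n (ℕ.+-monoˡ-≤ 1 2≤n)

-- Bypassing over D_1 and bicriticality of D_2 are separate inputs, because the hexagon D_{1,2} is
-- not bicritical. From D_2 on, bicriticality alone carries the induction.
module Tower (n : ℕ) (2≤n : 2 ≤ n) (𝓕₁ : Factorization (Adj 1 n) n)
             (bypass₁ : Level.Bypass 1 n 𝓕₁) (bicritical₂ : Matching.Bicritical Fin._≟_ (Adj 2 n)) where

  large : ∀ j → 6 ≤ t (suc j) n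
  large j = ℕ.≤-trans (t₁-≥6 2≤n) (t-≥-first j n)

  factorization : ∀ j → Factorization (Adj (suc j) n) (j + n)
  factorization zero = 𝓕₁
  factorization (suc j) = Level.next-factorization (suc j) n (factorization j)

  bicritical : ∀ j → Matching.Bicritical Fin._≟_ (Adj (suc (suc j)) n)
  bicritical zero = bicritical₂
  bicritical (suc j) = Level.next-bicritical (suc (suc j)) n (factorization (suc j)) zero
    (ℕ.≤-trans (ℕ.m≤n+m 4 2) (large (suc j))) (bicritical j)

  bypass : ∀ j → Level.Bypass (suc j) n (factorization j)
  bypass zero = bypass₁
  bypass (suc j) = Level.next-bypass (suc (suc j)) n (factorization (suc j)) (ℕ.≤-trans (ℕ.n≤1+n 5) (large (suc j))) (bicritical j)

  dcell-superMatched : ∀ j → IsMPNumber (DCell (suc (suc j)) n) (suc j + n) × SuperMatched (DCell (suc (suc j)) n)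
  dcell-superMatched j = mpNumber v , superMatched v (Level.next-perfect-or-star (suc j) n (factorization j) (bypass j))
    where
    open FiniteGraph (DCell (suc (suc j)) n) (λ {u} → adj-irr (suc (suc j)) n {u}) (factorization (suc j))
    v : Fin (t (suc (suc j)) n)
    v = fromℕ< {0} (ℕ.≤-trans (s≤s z≤n) (large (suc j)))

-- Base cases by parity of n, and the conclusion.

parity : ∀ n → ∃ λ h → n ≡ h + h ⊎ n ≡ suc (h + h)
parity zero = 0 , inj₁ refl
parity (suc n) with parity n
... | h , inj₁ refl = h , inj₂ refl
... | h , inj₂ refl = suc h , inj₁ (cong suc (sym (ℕ.+-suc h h)))

module _ {n : ℕ} where
  private
    module To₀ = Transport {_≟ᵛ_ = Fin._≟_} {_≟ʷ_ = Fin._≟_} (≢≅adj {n})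

  even-first : ∀ {d} → Factorization (_≢_ {A = Fin n}) (suc d) → 4 ≤ n →
    Factorization (Adj 1 n) (suc (suc d)) × Matching.Bicritical Fin._≟_ (Adj 1 n)
  even-first 𝓚 4≤n = Level.next-factorization 0 n 𝓕₀ ,
      Level.next-bicritical 0 n 𝓕₀ zero 4≤n (To₀.bicritical-transport (complete-bicritical 𝓚))
    where 𝓕₀ = To₀.factorization-transport 𝓚

  -- For odd n the graph K_n has no perfect matching, so D_1 is coloured directly through K_(n+1).
  odd-first : Factorization (_≢_ {A = Fin (suc n)}) n → 3 ≤ n →
    Factorization (Adj 1 n) n × Matching.Bicritical Fin._≟_ (Adj 1 n)
  odd-first 𝓚 3≤n = U₁.factorization-transport (U₀.factorization-transport first-factorization) ,
      U₁.bicritical-transport (U₀.bicritical-transport (first-bicritical 3≤n))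
    where
    open FirstLevel 𝓚
    module U₀ = Transport {_≟ᵛ_ = Pairs._≟_ n} {_≟ʷ_ = Pairs._≟_ n} {R = Pairs.Step n _≢_} {S = Pairs.Step n (Adj 0 n)}
      (step-≅ (_≅_.preserves ≢≅adj) (λ {x} {y} → _≅_.reflects ≢≅adj {x} {y}))
    module U₁ = Transport {_≟ᵛ_ = Pairs._≟_ n} {_≟ʷ_ = Fin._≟_} (UID.step≅adj 0 n)

first : ∀ n → 3 ≤ n → Factorization (Adj 1 n) n × Matching.Bicritical Fin._≟_ (Adj 1 n)
first n 3≤n with parity n
... | zero , inj₁ refl = contradiction 3≤n λ ()
... | suc zero , inj₁ refl = contradiction 3≤n λ { (s≤s (s≤s ())) }
-- Here n is 2h + 4, and the round robin runs modulo n - 1 = 2(h + 1) + 1.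
... | suc (suc h) , inj₁ refl = even-first (subst (λ m → Factorization (_≢_ {A = Fin (suc m)}) m) (sym (ℕ.+-suc (suc h) (suc h)))
        (RoundRobin.complete-factorization (suc h))) (ℕ.+-mono-≤ {2} (s≤s (s≤s z≤n)) (s≤s (s≤s z≤n)))
... | h , inj₂ refl = odd-first (RoundRobin.complete-factorization h) 3≤n

dcell : ∀ n → 2 ≤ n → ∀ j → IsMPNumber (DCell (suc (suc j)) n) (suc j + n) × SuperMatched (DCell (suc (suc j)) n)
dcell 1 (s≤s ())
dcell 2 2≤n = Tower.dcell-superMatched 2 2≤n Hexagon.hexagon Hexagon.hexagon-bypass
  (Transport.bicritical-transport {_≟ᵛ_ = Pairs._≟_ 6} {_≟ʷ_ = Fin._≟_} (UID.step≅adj 1 2) Hexagon.hexagon-step-bicritical)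
dcell n@(suc (suc (suc _))) 2≤n = Tower.dcell-superMatched n 2≤n (proj₁ base)
    -- For n at least 3, D_1 is bicritical, and both inputs at the bottom follow from that.
    (Level.next-bypass 1 n (proj₁ base) (ℕ.≤-trans (ℕ.n≤1+n 5) (t₁-≥6 2≤n)) (proj₂ base))
    (Level.next-bicritical 1 n (proj₁ base) zero (ℕ.≤-trans (ℕ.m≤n+m 4 2) (t₁-≥6 2≤n)) (proj₂ base))
  where base = first n (s≤s (s≤s (s≤s z≤n)))

theorem25 : (k n : ℕ) → 2 ≤ k → 2 ≤ n →
    IsMPNumber (DCell k n) (n + k ∸ 1) × SuperMatched (DCell k n)
theorem25 (suc (suc j)) n (s≤s (s≤s _)) 2≤n = subst (λ d → IsMPNumber (DCell (suc (suc j)) n) d × SuperMatched (DCell (suc (suc j)) n))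
  (cong (_∸ 1) (ℕ.+-comm (suc (suc j)) n)) (dcell n 2≤n j)
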